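{- Let $K$ be a finite simplicial complex with weight function $w$, and let $i\ge 0$ with $S_{i+1}(K)\neq\emptyset$. Then $$\lambda_{\max}(\mathcal L_i^{up}(K))\le \max_{F\in S_{i+1}(K)}\sum_{E\in S_i(K),\,E\subset F}\frac{\deg E}{w(E)}.$$ In particular, for $w\equiv 1$ (the combinatorial Laplacian $L_i^{up}(K)$), $$\lambda_{\max}(L_i^{up}(K))\le \max_{F\in S_{i+1}(K)}\sum_{E\in S_i(K),\,E\subset F}\deg E,$$ and if moreover $B_i(K)$ is connected, equality holds in the latter bound if and only if $B_i(K)$ is balanced and the sum $\sum_{E\in S_i(K),E\subset F}\deg E$ is the same for all $F\in S_{i+1}(K)$.
   Context: $S_j(K)$ is the set of faces of cardinality $j+1$ of the simplicial complex $K$. Fix an orientation (ordering of each face up to even permutations), and let $\mathrm{sgn}([E],\partial[F])\in\{\pm1\}$ for $E\in S_i(K)$, $E\subset F\in S_{i+1}(K)$ be the usual boundary incidence sign ($(-1)^j$ if $E$ is $F$ minus its $j$-th vertex and orientations agree, negated otherwise), $0$ if $E\not\subset F$. $D_i$ is the $S_{i+1}(K)\times S_i(K)$ matrix of these signs, $W_j=\mathrm{diag}(w(F))_{F\in S_j(K)}$ for $w:K\to\mathbb R_{>0}$, and $\mathcal L_i^{up}(K)=W_i^{ -1}D_i^\top W_{i+1}D_i$; $\lambda_{\max}$ is its largest eigenvalue (independent of the orientation). The degree of $E\in S_i(K)$ is $\deg E=\sum_{F\in S_{i+1}(K),E\subset F}w(F)$. $B_i(K)$ is the bipartite graph on $S_i(K)\cup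 S_{i+1}(K)$ with edges $\{E,F\}$ for $E\subset F$, signed by $\mathrm{sgn}([E],\partial[F])$; it is balanced if every cycle has positive sign product (this does not depend on the orientation). -}

module Defs where

open import Algebra.Bundles.Raw using (RawMonoid)
import Algebra.Definitions.RawMonoid as Sum
open import Data.Bool.Base using (Bool; T; if_then_else_)
open import Data.Bool.Properties using (T?)
open import Data.Empty using (⊥)
open import Data.Fin.Base as Fin using (Fin; toℕ)
import Data.Fin.Properties as Fin
open import Data.Fin.Subset using (Subset; inside; outside; ∣_∣; _⊆_; _⊂_; _-_; _∈_)
open import Data.Fin.Subset.Properties using (_⊂?_)
open import Data.Integer.Base as ℤ using (ℤ; 0ℤ; 1ℤ; -1ℤ)
open import Data.List.Base as List using (List; filter; length; _∷ʳ_)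
open import Data.List.Membership.Propositional.Properties using (∈-lookup)
import Data.List.Relation.Unary.All as All
open import Data.List.Relation.Unary.All.Properties using (all-filter)
open import Data.List.Relation.Unary.Linked using (Linked)
open import Data.List.Relation.Unary.Unique.Propositional using (Unique)
open import Data.Nat.Base as ℕ using (ℕ; zero; suc; NonZero; parity)
import Data.Nat.Properties as ℕ
import Data.Parity.Properties as Parity
open import Data.Product.Base using (∃; ∃-syntax; _×_; _,_; proj₁; proj₂)
open import Data.Rational.Base as ℚ using (ℚ; 0ℚ; 1ℚ; ½; 1/_; Positive)
import Data.Rational.Properties as ℚ
import Data.Rational.Solver as ℚ
open import Data.Sum.Base using (_⊎_; inj₁; inj₂)
open import Data.Vec.Base as Vec using (Vec; []; _∷_)
import Data.Vec.Membership.Propositional as Vec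
import Data.Vec.Properties as Vec
import Data.Vec.Relation.Unary.Unique.Propositional as Vec
import Data.Bool.Properties as Bool
open import Function.Base using (_∘_)
open import Function.Bundles using (_⇔_)
open import Level using (0ℓ)
open import Relation.Binary.Construct.Closure.ReflexiveTransitive using (Star)
open import Relation.Binary.PropositionalEquality
  using (_≡_; refl; sym; trans; cong; cong₂; subst)
open import Relation.Nullary using (¬_; Dec; yes; no; contradiction)
open import Relation.Nullary.Decidable using (⌊_⌋; _×-dec_)

------------------------------------------------------------------------
-- Real numbers, as Cauchy sequences of rationals up to _≈_

record ℝ : Set where
  constructor mkℝ
  field
    seq    : ℕ → ℚ
    cauchy : ∀ (ε : ℚ) .{{_ : Positive ε}} →
             ∃[ N ] (∀ m n → N ℕ.≤ m → N ℕ.≤ n → ℚ.∣ seq m ℚ.- seq n ∣ ℚ.< ε)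

open ℝ public

infix 4 _≈_ _<_ _≤_

_≈_ : ℝ → ℝ → Set
x ≈ y = ∀ (ε : ℚ) .{{_ : Positive ε}} →
        ∃[ N ] (∀ n → N ℕ.≤ n → ℚ.∣ seq x n ℚ.- seq y n ∣ ℚ.< ε)

_<_ : ℝ → ℝ → Set
x < y = ∃[ δ ] (Positive δ × ∃[ N ] (∀ n → N ℕ.≤ n → seq x n ℚ.+ δ ℚ.≤ seq y n))

_≤_ : ℝ → ℝ → Set
x ≤ y = ¬ (y < x)

module Rational where
  open ℚ.+-*-Solver
  open ℚ.≤-Reasoning

  ½-pos : ∀ ε .{{_ : Positive ε}} → Positive (½ ℚ.* ε)
  ½-pos ε = ℚ.pos*pos⇒pos ½ ε

  ½+½ : ∀ ε → ½ ℚ.* ε ℚ.+ ½ ℚ.* ε ≡ ε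
  ½+½ = solve 1 (λ ε → con ½ :* ε :+ con ½ :* ε := ε) refl

  0<pos : ∀ ε .{{_ : Positive ε}} → 0ℚ ℚ.< ε
  0<pos ε = ℚ.positive⁻¹ ε

  ∣∣-bound : ∀ {p b} → p ℚ.< b → ℚ.- p ℚ.< b → ℚ.∣ p ∣ ℚ.< b
  ∣∣-bound {p} {b} p<b -p<b with ℚ.∣p∣≡p∨∣p∣≡-p p
  ... | inj₁ e = subst (ℚ._< b) (sym e) p<b
  ... | inj₂ e = subst (ℚ._< b) (sym e) -p<b

  ≤∣∣ : ∀ p → p ℚ.≤ ℚ.∣ p ∣
  ≤∣∣ p with ℚ.∣p∣≡p∨∣p∣≡-p p
  ... | inj₁ e = ℚ.≤-reflexive (sym e)
  ... | inj₂ e with ℚ.≤-total 0ℚ p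
  ...   | inj₁ 0≤p = ℚ.≤-reflexive (sym (ℚ.0≤p⇒∣p∣≡p 0≤p))
  ...   | inj₂ p≤0 = ℚ.≤-trans p≤0 (ℚ.0≤∣p∣ p)

  dist⇒< : ∀ p q {b} → ℚ.∣ p ℚ.- q ∣ ℚ.< b → p ℚ.< q ℚ.+ b
  dist⇒< p q {b} h = begin-strict
    p                   ≡⟨ solve 2 (λ p q → p := q :+ (p :- q)) refl p q ⟩
    q ℚ.+ (p ℚ.- q)     <⟨ ℚ.+-monoʳ-< q (ℚ.≤-<-trans (≤∣∣ (p ℚ.- q)) h) ⟩
    q ℚ.+ b             ∎

  ∣-∣-sym : ∀ p q → ℚ.∣ p ℚ.- q ∣ ≡ ℚ.∣ q ℚ.- p ∣
  ∣-∣-sym p q = trans (sym (ℚ.∣-p∣≡∣p∣ (p ℚ.- q)))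
    (cong ℚ.∣_∣ (solve 2 (λ p q → :- (p :- q) := q :- p) refl p q))

  <⇒dist : ∀ p q {b} → p ℚ.< q ℚ.+ b → q ℚ.< p ℚ.+ b → ℚ.∣ p ℚ.- q ∣ ℚ.< b
  <⇒dist p q {b} h₁ h₂ = ∣∣-bound (shift p q h₁)
    (subst (ℚ._< b) (solve 2 (λ p q → q :- p := :- (p :- q)) refl p q) (shift q p h₂))
    where
    shift : ∀ p q → p ℚ.< q ℚ.+ b → p ℚ.- q ℚ.< b
    shift p q h = begin-strict
      p ℚ.- q             <⟨ ℚ.+-monoˡ-< (ℚ.- q) h ⟩
      q ℚ.+ b ℚ.- q       ≡⟨ solve 2 (λ q b → q :+ b :- q := b) refl q b ⟩
      b                   ∎

  +-dist : ∀ a b c d {ε} → ℚ.∣ a ℚ.- c ∣ ℚ.< ½ ℚ.* ε → ℚ.∣ b ℚ.- d ∣ ℚ.< ½ ℚ.* ε →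
           ℚ.∣ (a ℚ.+ b) ℚ.- (c ℚ.+ d) ∣ ℚ.< ε
  +-dist a b c d {ε} h₁ h₂ = begin-strict
    ℚ.∣ (a ℚ.+ b) ℚ.- (c ℚ.+ d) ∣
      ≡⟨ cong ℚ.∣_∣ (solve 4 (λ a b c d → (a :+ b) :- (c :+ d) := (a :- c) :+ (b :- d)) refl a b c d) ⟩
    ℚ.∣ (a ℚ.- c) ℚ.+ (b ℚ.- d) ∣
      ≤⟨ ℚ.∣p+q∣≤∣p∣+∣q∣ (a ℚ.- c) (b ℚ.- d) ⟩
    ℚ.∣ a ℚ.- c ∣ ℚ.+ ℚ.∣ b ℚ.- d ∣
      <⟨ ℚ.+-mono-< h₁ h₂ ⟩
    ½ ℚ.* ε ℚ.+ ½ ℚ.* ε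
      ≡⟨ ½+½ ε ⟩
    ε ∎

  ⊔-< : ∀ p q {c} → p ℚ.< c → q ℚ.< c → p ℚ.⊔ q ℚ.< c
  ⊔-< p q {c} h₁ h₂ with ℚ.⊔-sel p q
  ... | inj₁ e = subst (ℚ._< c) (sym e) h₁
  ... | inj₂ e = subst (ℚ._< c) (sym e) h₂

  ⊔-dist : ∀ a b c d {ε} → ℚ.∣ a ℚ.- c ∣ ℚ.< ε → ℚ.∣ b ℚ.- d ∣ ℚ.< ε →
           ℚ.∣ (a ℚ.⊔ b) ℚ.- (c ℚ.⊔ d) ∣ ℚ.< ε
  ⊔-dist a b c d {ε} h₁ h₂ = <⇒dist (a ℚ.⊔ b) (c ℚ.⊔ d) (half a b c d h₁ h₂)
    (half c d a b (subst (ℚ._< ε) (∣-∣-sym a c) h₁) (subst (ℚ._< ε) (∣-∣-sym b d) h₂))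
    where
    half : ∀ a b c d → ℚ.∣ a ℚ.- c ∣ ℚ.< ε → ℚ.∣ b ℚ.- d ∣ ℚ.< ε →
           a ℚ.⊔ b ℚ.< (c ℚ.⊔ d) ℚ.+ ε
    half a b c d h₁ h₂ = ⊔-< a b
      (ℚ.<-≤-trans (dist⇒< a c h₁) (ℚ.+-monoˡ-≤ ε (ℚ.p≤p⊔q c d)))
      (ℚ.<-≤-trans (dist⇒< b d h₂) (ℚ.+-monoˡ-≤ ε (ℚ.p≤q⊔p c d)))

  tolerance : ∀ ε b .{{_ : Positive ε}} .{{_ : Positive b}} →
              ∃[ δ ] (Positive δ × b ℚ.* δ ≡ ½ ℚ.* ε)
  tolerance ε b = ½ ℚ.* ε ℚ.* i ,
    ℚ.pos*pos⇒pos (½ ℚ.* ε) {{½-pos ε}} i {{ℚ.1/pos⇒pos b}} , (begin-equality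
      b ℚ.* (½ ℚ.* ε ℚ.* i)
        ≡⟨ solve 3 (λ b h i → b :* (h :* i) := h :* (b :* i)) refl b (½ ℚ.* ε) i ⟩
      ½ ℚ.* ε ℚ.* (b ℚ.* i)   ≡⟨ cong (½ ℚ.* ε ℚ.*_) (ℚ.*-inverseʳ b {{ℚ.pos⇒nonZero b}}) ⟩
      ½ ℚ.* ε ℚ.* 1ℚ          ≡⟨ ℚ.*-identityʳ (½ ℚ.* ε) ⟩
      ½ ℚ.* ε                 ∎)
    where i = (1/ b) {{ℚ.pos⇒nonZero b}}

  *-bound : ∀ p q b e .{{_ : Positive b}} → ℚ.∣ p ∣ ℚ.< b → ℚ.∣ q ∣ ℚ.< e →
            ℚ.∣ p ℚ.* q ∣ ℚ.< b ℚ.* e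
  *-bound p q b e h₁ h₂ = begin-strict
    ℚ.∣ p ℚ.* q ∣        ≡⟨ ℚ.∣p*q∣≡∣p∣*∣q∣ p q ⟩
    ℚ.∣ p ∣ ℚ.* ℚ.∣ q ∣  ≤⟨ ℚ.*-monoʳ-≤-nonNeg ℚ.∣ q ∣ {{ℚ.∣-∣-nonNeg q}} (ℚ.<⇒≤ h₁) ⟩
    b ℚ.* ℚ.∣ q ∣        <⟨ ℚ.*-monoʳ-<-pos b h₂ ⟩
    b ℚ.* e              ∎

  *-dist : ∀ a b c d B C β γ ε .{{_ : Positive B}} .{{_ : Positive C}} →
           B ℚ.* β ≡ ½ ℚ.* ε → C ℚ.* γ ≡ ½ ℚ.* ε →
           ℚ.∣ a ∣ ℚ.< B → ℚ.∣ d ∣ ℚ.< C →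
           ℚ.∣ a ℚ.- c ∣ ℚ.< γ → ℚ.∣ b ℚ.- d ∣ ℚ.< β →
           ℚ.∣ (a ℚ.* b) ℚ.- (c ℚ.* d) ∣ ℚ.< ε
  *-dist a b c d B C β γ ε eB eC ha hd h₁ h₂ = begin-strict
    ℚ.∣ (a ℚ.* b) ℚ.- (c ℚ.* d) ∣
      ≡⟨ cong ℚ.∣_∣ (solve 4 (λ a b c d → (a :* b) :- (c :* d) := (a :* (b :- d)) :+ (d :* (a :- c))) refl a b c d) ⟩
    ℚ.∣ (a ℚ.* (b ℚ.- d)) ℚ.+ (d ℚ.* (a ℚ.- c)) ∣
      ≤⟨ ℚ.∣p+q∣≤∣p∣+∣q∣ (a ℚ.* (b ℚ.- d)) (d ℚ.* (a ℚ.- c)) ⟩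
    ℚ.∣ a ℚ.* (b ℚ.- d) ∣ ℚ.+ ℚ.∣ d ℚ.* (a ℚ.- c) ∣
      <⟨ ℚ.+-mono-< (*-bound a (b ℚ.- d) B β ha h₂) (*-bound d (a ℚ.- c) C γ hd h₁) ⟩
    B ℚ.* β ℚ.+ C ℚ.* γ
      ≡⟨ cong₂ ℚ._+_ eB eC ⟩
    ½ ℚ.* ε ℚ.+ ½ ℚ.* ε
      ≡⟨ ½+½ ε ⟩
    ε ∎

  bounded : ∀ x → ∃[ B ] (Positive B × ∃[ N ] (∀ n → N ℕ.≤ n → ℚ.∣ seq x n ∣ ℚ.< B))
  bounded x with cauchy x 1ℚ
  ... | N , h = ℚ.∣ seq x N ∣ ℚ.+ 1ℚ ,
    ℚ.nonNeg+pos⇒pos ℚ.∣ seq x N ∣ {{ℚ.∣-∣-nonNeg (seq x N)}} 1ℚ ,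
    N , λ n N≤n → begin-strict
      ℚ.∣ seq x n ∣
        ≡⟨ cong ℚ.∣_∣ (solve 2 (λ p q → p := q :+ (p :- q)) refl (seq x n) (seq x N)) ⟩
      ℚ.∣ seq x N ℚ.+ (seq x n ℚ.- seq x N) ∣
        ≤⟨ ℚ.∣p+q∣≤∣p∣+∣q∣ (seq x N) (seq x n ℚ.- seq x N) ⟩
      ℚ.∣ seq x N ∣ ℚ.+ ℚ.∣ seq x n ℚ.- seq x N ∣
        <⟨ ℚ.+-monoʳ-< ℚ.∣ seq x N ∣ (h n N N≤n ℕ.≤-refl) ⟩
      ℚ.∣ seq x N ∣ ℚ.+ 1ℚ ∎

fromℚ : ℚ → ℝ
fromℚ q = mkℝ (λ _ → q) λ ε → 0 , λ _ _ _ _ →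
  subst (ℚ._< ε) (sym (cong ℚ.∣_∣ (ℚ.+-inverseʳ q))) (Rational.0<pos ε)

fromℤ : ℤ → ℝ
fromℤ z = fromℚ (z ℚ./ 1)

0ℝ 1ℝ : ℝ
0ℝ = fromℚ 0ℚ
1ℝ = fromℚ 1ℚ

infixl 6 _+_ _⊔_
infixl 7 _*_

_+_ : ℝ → ℝ → ℝ
x + y = mkℝ (λ n → seq x n ℚ.+ seq y n) λ ε →
  let N , hx = cauchy x (½ ℚ.* ε) {{Rational.½-pos ε}}
      M , hy = cauchy y (½ ℚ.* ε) {{Rational.½-pos ε}}
  in N ℕ.⊔ M , λ m n p q → Rational.+-dist (seq x m) (seq y m) (seq x n) (seq y n)
       (hx m n (ℕ.m⊔n≤o⇒m≤o N M p) (ℕ.m⊔n≤o⇒m≤o N M q))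
       (hy m n (ℕ.m⊔n≤o⇒n≤o N M p) (ℕ.m⊔n≤o⇒n≤o N M q))

_⊔_ : ℝ → ℝ → ℝ
x ⊔ y = mkℝ (λ n → seq x n ℚ.⊔ seq y n) λ ε →
  let N , hx = cauchy x ε
      M , hy = cauchy y ε
  in N ℕ.⊔ M , λ m n p q → Rational.⊔-dist (seq x m) (seq y m) (seq x n) (seq y n)
       (hx m n (ℕ.m⊔n≤o⇒m≤o N M p) (ℕ.m⊔n≤o⇒m≤o N M q))
       (hy m n (ℕ.m⊔n≤o⇒n≤o N M p) (ℕ.m⊔n≤o⇒n≤o N M q))

*-cauchy : ∀ (x y : ℝ) (ε : ℚ) .{{_ : Positive ε}} →
  ∃[ N ] (∀ m n → N ℕ.≤ m → N ℕ.≤ n →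
    ℚ.∣ seq x m ℚ.* seq y m ℚ.- seq x n ℚ.* seq y n ∣ ℚ.< ε)
*-cauchy x y ε {{ε>0}} =
  let B , B>0 , N₁ , hB = Rational.bounded x
      C , C>0 , N₂ , hC = Rational.bounded y
      β , β>0 , eB = Rational.tolerance ε B {{ε>0}} {{B>0}}
      γ , γ>0 , eC = Rational.tolerance ε C {{ε>0}} {{C>0}}
      N₃ , hx = cauchy x γ {{γ>0}}
      N₄ , hy = cauchy y β {{β>0}}
      M  = N₁ ℕ.⊔ N₂
      M′ = N₃ ℕ.⊔ N₄
      split = λ (k : ℕ) (p : M ℕ.⊔ M′ ℕ.≤ k) → ℕ.m⊔n≤o⇒m≤o M M′ p , ℕ.m⊔n≤o⇒n≤o M M′ p
  in M ℕ.⊔ M′ , λ m n p q →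
    Rational.*-dist (seq x m) (seq y m) (seq x n) (seq y n) B C β γ ε {{B>0}} {{C>0}} eB eC
      (hB m (ℕ.m⊔n≤o⇒m≤o N₁ N₂ (proj₁ (split m p))))
      (hC n (ℕ.m⊔n≤o⇒n≤o N₁ N₂ (proj₁ (split n q))))
      (hx m n (ℕ.m⊔n≤o⇒m≤o N₃ N₄ (proj₂ (split m p))) (ℕ.m⊔n≤o⇒m≤o N₃ N₄ (proj₂ (split n q))))
      (hy m n (ℕ.m⊔n≤o⇒n≤o N₃ N₄ (proj₂ (split m p))) (ℕ.m⊔n≤o⇒n≤o N₃ N₄ (proj₂ (split n q))))

_*_ : ℝ → ℝ → ℝ
x * y = mkℝ (λ n → seq x n ℚ.* seq y n) (*-cauchy x y)

ℝ⁺ : Set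
ℝ⁺ = ∃[ x ] 0ℝ < x

1ℝ⁺ : ℝ⁺
1ℝ⁺ = 1ℝ , 1ℚ , _ , 0 , λ _ _ → ℚ.≤-refl

-- Only entries bounded away from 0 matter in recip, so the value at 0 is junk.
recipℚ : ℚ → ℚ
recipℚ q with q ℚ.≟ 0ℚ
... | yes _  = 0ℚ
... | no q≢0 = (1/ q) {{ℚ.≢-nonZero q≢0}}

module Reciprocal where
  open ℚ.+-*-Solver
  open ℚ.≤-Reasoning

  recipℚ-inverse : ∀ q → 0ℚ ℚ.< q → q ℚ.* recipℚ q ≡ 1ℚ
  recipℚ-inverse q 0<q with q ℚ.≟ 0ℚ
  ... | yes refl = contradiction 0<q (ℚ.<-irrefl refl)
  ... | no q≢0   = ℚ.*-inverseʳ q {{ℚ.≢-nonZero q≢0}}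

  recipℚ-dist : ∀ a b δ ε .{{_ : Positive δ}} .{{_ : Positive ε}} →
    δ ℚ.≤ a → δ ℚ.≤ b → ℚ.∣ a ℚ.- b ∣ ℚ.< ε ℚ.* (δ ℚ.* δ) →
    ℚ.∣ recipℚ a ℚ.- recipℚ b ∣ ℚ.< ε
  recipℚ-dist a b δ ε δ≤a δ≤b h =
    ℚ.*-cancelʳ-<-nonNeg (δ ℚ.* δ) {{ℚ.pos⇒nonNeg (δ ℚ.* δ) {{ℚ.pos*pos⇒pos δ δ}}}} (begin-strict
      D ℚ.* (δ ℚ.* δ)
        ≤⟨ ℚ.*-monoˡ-≤-nonNeg D {{ℚ.∣-∣-nonNeg (a⁻ ℚ.- b⁻)}} δδ≤ab ⟩
      D ℚ.* (a ℚ.* b)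
        ≡⟨ cong (D ℚ.*_) (ℚ.0≤p⇒∣p∣≡p 0≤ab) ⟨
      D ℚ.* ℚ.∣ a ℚ.* b ∣
        ≡⟨ ℚ.∣p*q∣≡∣p∣*∣q∣ (a⁻ ℚ.- b⁻) (a ℚ.* b) ⟨
      ℚ.∣ (a⁻ ℚ.- b⁻) ℚ.* (a ℚ.* b) ∣
        ≡⟨ cong ℚ.∣_∣ (solve 4 (λ a b i j → (i :- j) :* (a :* b) := b :* (a :* i) :- a :* (b :* j)) refl a b a⁻ b⁻) ⟩
      ℚ.∣ b ℚ.* (a ℚ.* a⁻) ℚ.- a ℚ.* (b ℚ.* b⁻) ∣
        ≡⟨ cong ℚ.∣_∣ (cong₂ (λ u v → b ℚ.* u ℚ.- a ℚ.* v) (recipℚ-inverse a 0<a) (recipℚ-inverse b 0<b)) ⟩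
      ℚ.∣ b ℚ.* 1ℚ ℚ.- a ℚ.* 1ℚ ∣
        ≡⟨ cong ℚ.∣_∣ (cong₂ ℚ._-_ (ℚ.*-identityʳ b) (ℚ.*-identityʳ a)) ⟩
      ℚ.∣ b ℚ.- a ∣
        ≡⟨ Rational.∣-∣-sym b a ⟩
      ℚ.∣ a ℚ.- b ∣
        <⟨ h ⟩
      ε ℚ.* (δ ℚ.* δ) ∎)
    where
    a⁻ = recipℚ a
    b⁻ = recipℚ b
    D  = ℚ.∣ a⁻ ℚ.- b⁻ ∣
    0<a = ℚ.<-≤-trans (Rational.0<pos δ) δ≤a
    0<b = ℚ.<-≤-trans (Rational.0<pos δ) δ≤b
    δδ≤ab : δ ℚ.* δ ℚ.≤ a ℚ.* b
    δδ≤ab = begin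
      δ ℚ.* δ ≤⟨ ℚ.*-monoˡ-≤-nonNeg δ {{ℚ.pos⇒nonNeg δ}} δ≤b ⟩
      δ ℚ.* b ≤⟨ ℚ.*-monoʳ-≤-nonNeg b {{ℚ.nonNegative (ℚ.<⇒≤ 0<b)}} δ≤a ⟩
      a ℚ.* b ∎
    0≤ab : 0ℚ ℚ.≤ a ℚ.* b
    0≤ab = ℚ.≤-trans (ℚ.<⇒≤ (Rational.0<pos (δ ℚ.* δ) {{ℚ.pos*pos⇒pos δ δ}})) δδ≤ab

  recip-cauchy : ∀ (x : ℝ) → 0ℝ < x → (ε : ℚ) .{{_ : Positive ε}} →
    ∃[ N ] (∀ m n → N ℕ.≤ m → N ℕ.≤ n → ℚ.∣ recipℚ (seq x m) ℚ.- recipℚ (seq x n) ∣ ℚ.< ε)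
  recip-cauchy x (δ , δ>0 , M , h) ε
    with cauchy x (ε ℚ.* (δ ℚ.* δ))
           {{ℚ.pos*pos⇒pos ε (δ ℚ.* δ) {{ℚ.pos*pos⇒pos δ {{δ>0}} δ {{δ>0}}}}}}
  ... | N , hx = M ℕ.⊔ N , λ m n p q →
    recipℚ-dist (seq x m) (seq x n) δ ε {{δ>0}}
      (above m (ℕ.m⊔n≤o⇒m≤o M N p)) (above n (ℕ.m⊔n≤o⇒m≤o M N q))
      (hx m n (ℕ.m⊔n≤o⇒n≤o M N p) (ℕ.m⊔n≤o⇒n≤o M N q))
    where
    above : ∀ n → M ℕ.≤ n → δ ℚ.≤ seq x n
    above n M≤n = subst (ℚ._≤ seq x n) (ℚ.+-identityˡ δ) (h n M≤n)

recip : ℝ⁺ → ℝ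
recip (x , 0<x) = mkℝ (recipℚ ∘ seq x) (Reciprocal.recip-cauchy x 0<x)

+-0-rawMonoid : RawMonoid 0ℓ 0ℓ
+-0-rawMonoid = record { Carrier = ℝ ; _≈_ = _≈_ ; _∙_ = _+_ ; ε = 0ℝ }

open Sum +-0-rawMonoid public using (sum)

max : ∀ {m} .{{_ : NonZero m}} → (Fin m → ℝ) → ℝ
max {suc zero}    f = f Fin.zero
max {suc (suc m)} f = f Fin.zero ⊔ max (f ∘ Fin.suc)

------------------------------------------------------------------------
-- Real matrices and eigenvalues

Matrix : ℕ → ℕ → Set
Matrix m n = Fin m → Fin n → ℝ

infixl 7 _⊗_ _·_
infix  8 _ᵀ

_⊗_ : ∀ {l m n} → Matrix l m → Matrix m n → Matrix l n
(A ⊗ B) i k = sum λ j → A i j * B j k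

_·_ : ∀ {m n} → Matrix m n → (Fin n → ℝ) → Fin m → ℝ
(A · v) i = sum λ j → A i j * v j

_ᵀ : ∀ {m n} → Matrix m n → Matrix n m
(A ᵀ) i j = A j i

diag : ∀ {n} → (Fin n → ℝ) → Matrix n n
diag d i j = if ⌊ i Fin.≟ j ⌋ then d i else 0ℝ

-- The double negation makes this the classical notion: over constructive
-- reals even a symmetric matrix need not have an eigenvector that can be
-- exhibited, because eigenvectors do not depend continuously on the entries.
IsEigenvalue : ∀ {n} → Matrix n n → ℝ → Set
IsEigenvalue A μ = ¬ ¬ (∃[ v ] (¬ (∀ i → v i ≈ 0ℝ)) × (∀ i → (A · v) i ≈ μ * v i))

IsLargestEigenvalue : ∀ {n} → Matrix n n → ℝ → Set
IsLargestEigenvalue A μ = IsEigenvalue A μ × (∀ ν → IsEigenvalue A ν → ν ≤ μ)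

------------------------------------------------------------------------
-- Finite simplicial complexes

record SimplicialComplex : Set where
  field
    vertices : ℕ
    isFace   : Subset vertices → Bool

  Face : Subset vertices → Set
  Face s = T (isFace s)

  field
    downClosed : ∀ {s t} → s ⊆ t → Face t → Face s

subsets : ∀ n → List (Subset n)
subsets zero    = [] List.∷ List.[]
subsets (suc n) = List.map (outside ∷_) (subsets n) List.++ List.map (inside ∷_) (subsets n)

inversions : ∀ {n m} → Vec (Fin n) m → ℕ
inversions []       = 0
inversions (x ∷ xs) = Vec.count (Fin._<? x) xs ℕ.+ inversions xs

-- Two arrangements of the same distinct vertices differ by an even permutation
-- exactly when their numbers of inversions have the same parity.
SameOrientation : ∀ {n m} → Vec (Fin n) m → Vec (Fin n) m → Set
SameOrientation xs ys = parity (inversions xs) ≡ parity (inversions ys)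

sameOrientation? : ∀ {n m} (xs ys : Vec (Fin n) m) → Dec (SameOrientation xs ys)
sameOrientation? xs ys = parity (inversions xs) Parity.≟ parity (inversions ys)

record Ordering {n} (s : Subset n) (m : ℕ) : Set where
  field
    sequence : Vec (Fin n) m
    unique   : Vec.Unique sequence
    complete : ∀ x → x ∈ s ⇔ x Vec.∈ sequence

open Ordering public

module _ (K : SimplicialComplex) where
  open SimplicialComplex K

  -- Contains the empty face when K does; its weight is never used.
  Simplex : Set
  Simplex = ∃ Face

  ofDim? : ∀ j s → Dec (Face s × ∣ s ∣ ≡ suc j)
  ofDim? j s = T? (isFace s) ×-dec (∣ s ∣ ℕ.≟ suc j)

  faces : ℕ → List (Subset vertices)
  faces j = filter (ofDim? j) (subsets vertices)

  #S : ℕ → ℕ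
  #S j = length (faces j)

  S : ℕ → Set
  S j = Fin (#S j)

  module _ {j : ℕ} where

    set : S j → Subset vertices
    set = List.lookup (faces j)

    simplex : S j → Simplex
    simplex E = set E ,
      proj₁ (All.lookup (all-filter (ofDim? j) (subsets vertices)) (∈-lookup {xs = faces j} E))

  Weight : Set
  Weight = Simplex → ℝ⁺

  unitWeight : Weight
  unitWeight _ = 1ℝ⁺

  -- An orientation is an ordering up to even permutation; it is given here by
  -- a representative of its class, and only the class affects sgn.
  Orientation : Set
  Orientation = ∀ {j} (E : S j) → Ordering (set E) (suc j)

  module _ {i : ℕ} where

    infix 4 _⊏_ _⊏?_

    _⊏_ : S i → S (suc i) → Set
    E ⊏ F = set E ⊂ set F

    _⊏?_ : ∀ E F → Dec (E ⊏ F)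
    E ⊏? F = set E ⊂? set F

    sumOverFacets : S (suc i) → (S i → ℝ) → ℝ
    sumOverFacets F f = sum λ E → if ⌊ E ⊏? F ⌋ then f E else 0ℝ

    deg : Weight → S i → ℝ
    deg w E = sum λ F → if ⌊ E ⊏? F ⌋ then proj₁ (w (simplex F)) else 0ℝ

    sgn : Orientation → S i → S (suc i) → ℤ
    sgn o E F with Fin.any? (λ j → Vec.≡-dec Bool._≟_ (set E) (set F - Vec.lookup (sequence (o F)) j))
    ... | no _ = 0ℤ
    ... | yes (j , _) with sameOrientation? (sequence (o E)) (Vec.removeAt (sequence (o F)) j)
    ...   | yes _ = -1ℤ ℤ.^ toℕ j
    ...   | no _  = ℤ.- (-1ℤ ℤ.^ toℕ j)

  D : Orientation → ∀ i → Matrix (#S (suc i)) (#S i)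
  D o i F E = fromℤ (sgn o E F)

  W W⁻¹ : Weight → ∀ j → Matrix (#S j) (#S j)
  W   w j = diag λ F → proj₁ (w (simplex F))
  W⁻¹ w j = diag λ F → recip (w (simplex F))

  𝓛up : Weight → Orientation → ∀ i → Matrix (#S i) (#S i)
  𝓛up w o i = W⁻¹ w i ⊗ D o i ᵀ ⊗ W w (suc i) ⊗ D o i

  Lup : Orientation → ∀ i → Matrix (#S i) (#S i)
  Lup = 𝓛up unitWeight

  module B (i : ℕ) where

    Vertex : Set
    Vertex = S i ⊎ S (suc i)

    Adjacent : Vertex → Vertex → Set
    Adjacent (inj₁ E) (inj₂ F) = E ⊏ F
    Adjacent (inj₂ F) (inj₁ E) = E ⊏ F
    Adjacent (inj₁ _) (inj₁ _) = ⊥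
    Adjacent (inj₂ _) (inj₂ _) = ⊥

    Connected : Set
    Connected = ∀ u v → Star Adjacent u v

    -- The cycle x, x₁, …, xₖ, x with xs = x₁, …, xₖ.
    record IsCycle (x : Vertex) (xs : List Vertex) : Set where
      field
        distinct : Unique (x List.∷ xs)
        long     : 2 ℕ.≤ length xs
        adjacent : Linked Adjacent (x List.∷ xs ∷ʳ x)

    edgeSign : Orientation → Vertex → Vertex → ℤ
    edgeSign o (inj₁ E) (inj₂ F) = sgn o E F
    edgeSign o (inj₂ F) (inj₁ E) = sgn o E F
    edgeSign o (inj₁ _) (inj₁ _) = 0ℤ
    edgeSign o (inj₂ _) (inj₂ _) = 0ℤ

    walkSign : Orientation → List Vertex → ℤ
    walkSign o (u List.∷ vs@(v List.∷ _)) = edgeSign o u v ℤ.* walkSign o vs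
    walkSign o _                          = 1ℤ

    Balanced : Orientation → Set
    Balanced o = ∀ x xs → IsCycle x xs → 0ℤ ℤ.< walkSign o (x List.∷ xs ∷ʳ x)

{-# OPTIONS --safe #-}

-- With x = D v, an eigenvector v of W⁻¹ Dᵀ W′ D for μ ≠ 0 yields an eigenvector
-- x of D W⁻¹ Dᵀ W′, and reading the eigenvalue equation at an entry of x of
-- maximal absolute value bounds μ by a row sum of absolute values, which is the
-- sum in the theorem.  In case of equality both triangle inequalities used are
-- equalities, so the neighbours of an extremal row are extremal with signs
-- forced by D; by connectedness the signs of x are a potential for the signed
-- graph, which is Harary's criterion for balance.  Conversely a potential
-- conjugates D to its entrywise absolute value, and the constant row sum becomes
-- an eigenvalue.  Attained maxima and eigenvectors exist only up to double
-- negation, but every conclusion is stable under it.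

module Submission where

open import Algebra.Bundles using (CommutativeRing)
open import Algebra.Definitions.RawMonoid using () renaming (sum to ∑)
import Algebra.Properties.CommutativeSemigroup
import Algebra.Properties.Ring
import Algebra.Properties.Semiring.Sum
open import Algebra.Structures using (IsCommutativeRing)
open import Data.Bool.Base using (if_then_else_)
import Data.Bool.Properties as Bool
open import Data.Fin.Base using (Fin; zero; suc; toℕ)
import Data.Fin.Properties as Fin
open import Data.Fin.Subset as Subset using (∣_∣)
import Data.Fin.Subset.Properties as Subset
open import Data.Integer.Base as ℤ using (ℤ; 0ℤ; 1ℤ; -1ℤ)
import Data.Integer.Properties as ℤ
open import Data.List.Base using (List; []; _∷_; _∷ʳ_; length)
import Data.List.Membership.DecPropositional as DecMembership
open import Data.List.Membership.Propositional using (_∈_)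
open import Data.List.Membership.Propositional.Properties using (∈-lookup)
open import Data.List.Relation.Unary.All as All using ([]; _∷_)
open import Data.List.Relation.Unary.All.Properties using (all-filter; ¬Any⇒All¬)
open import Data.List.Relation.Unary.AllPairs using ([]; _∷_)
open import Data.List.Relation.Unary.Any using (here; there)
open import Data.List.Relation.Unary.Linked using (Linked; [-]; _∷_)
open import Data.List.Relation.Unary.Unique.Propositional using (Unique)
open import Data.Nat.Base as ℕ using (ℕ; zero; suc; z≤n; s≤s; NonZero)
import Data.Nat.Properties as ℕ
open import Data.Product.Base using (∃; ∃-syntax; _×_; _,_; proj₁; proj₂)
open import Data.Rational.Base as ℚ using (0ℚ; 1ℚ; ½; 1/_; Positive)
import Data.Rational.Properties as ℚ
import Data.Rational.Solver as ℚ
open import Data.Sum.Base as Sum using (_⊎_; inj₁; inj₂; [_,_])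
open import Data.Sum.Properties using (≡-dec)
import Data.Vec.Base as Vec
import Data.Vec.Membership.Propositional.Properties as Vec
import Data.Vec.Properties as Vec
import Data.Vec.Relation.Unary.Any as VecAny
import Data.Vec.Relation.Unary.Any.Properties as VecAny
open import Function.Base using (_∘_)
open import Function.Bundles using (_⇔_; mk⇔; Equivalence)
open import Level using (0ℓ)
open import Relation.Binary.Bundles using (Poset; Setoid)
open import Relation.Binary.Definitions using (DecidableEquality)
open import Relation.Binary.PropositionalEquality as ≡
  using (_≡_; refl; sym; trans; cong; cong₂; subst; subst₂; module ≡-Reasoning)
import Relation.Binary.Reasoning.PartialOrder
import Relation.Binary.Reasoning.Setoid
open import Relation.Binary.Structures using (IsEquivalence)
open import Relation.Nullary using (¬_; Dec; yes; no; contradiction)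
open import Relation.Nullary.Decidable using (⌊_⌋; decidable-stable; ¬¬-excluded-middle)

-- Passing from `v` to `D v` is what brings in the degrees. The operator `D W⁻¹ Dᵀ W′` is estimated
-- through its factors: an inner sum over the cofaces of `E`, of size at most `deg E` times the
-- maximum, and an outer sum over the facets of `F` with weights `1 / w(E)`. Keeping the two
-- triangle inequalities apart makes the equality case local: tightness of the outer one at an
-- extremal `F` makes the inner one tight at every facet of `F`, and through that facet reaches all
-- of its other cofaces.
--
-- The eigenvalue 0 escapes the passage to `D v`. For the bound it suffices that the row sums are
-- nonnegative; in the equality case a row sum is nonzero as soon as its face has a facet, which
-- makes the eigenvalue positive.
--
-- The order on Cauchy reals is undecidable, so cotransitivity and tightness of `<` replace
-- trichotomy, and the signs stay integers, on which cases can be distinguished.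

record IsOrderedRing {A : Set} (_≈_ _<_ : A → A → Set) (_+_ _*_ : A → A → A) (-_ : A → A) (0# 1# : A)
  (sum : ∀ {n} → (Fin n → A) → A) (⟦_⟧ : ℤ → A) : Set where
  field
    isCommutativeRing : IsCommutativeRing _≈_ _+_ _*_ -_ 0# 1#
    <-irrefl  : ∀ {x} → ¬ (x < x)
    <-respˡ-≈ : ∀ {x y z} → x ≈ y → x < z → y < z
    <-respʳ-≈ : ∀ {x y z} → x ≈ y → z < x → z < y
    <-trans   : ∀ {x y z} → x < y → y < z → x < z
    <-cotrans : ∀ {x y} z → x < y → (x < z) ⊎ (z < y)
    <-tight   : ∀ {x y} → ¬ (x < y) → ¬ (y < x) → x ≈ y
    +-monoˡ-< : ∀ z {x y} → x < y → (x + z) < (y + z)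
    *-monoˡ-< : ∀ {z} → 0# < z → ∀ {x y} → x < y → (z * x) < (z * y)
    sum-[]    : (f : Fin 0 → A) → sum f ≈ 0#
    sum-∷     : ∀ {n} (f : Fin (ℕ.suc n) → A) → sum f ≈ (f zero + sum (f ∘ suc))
    ⟦0⟧       : ⟦ 0ℤ ⟧ ≈ 0#
    ⟦1⟧       : ⟦ 1ℤ ⟧ ≈ 1#
    ⟦-1⟧      : ⟦ -1ℤ ⟧ ≈ (- 1#)

-- The operations are fields, so that instantiating the lemmas below with a
-- record in constructor form gives statements in terms of the given operations.
-- Comparing real numbers up to conversion would unfold their Cauchy proofs.
record OrderedRing : Set₁ where
  constructor orderedRing
  infix  4 _≈_ _<_
  infixl 6 _+_
  infixl 7 _*_
  infix  8 -_
  field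
    Carrier       : Set
    _≈_ _<_       : Carrier → Carrier → Set
    _+_ _*_       : Carrier → Carrier → Carrier
    -_            : Carrier → Carrier
    0# 1#         : Carrier
    sum           : ∀ {n} → (Fin n → Carrier) → Carrier
    ⟦_⟧           : ℤ → Carrier
    isOrderedRing : IsOrderedRing _≈_ _<_ _+_ _*_ -_ 0# 1# sum ⟦_⟧

  open IsOrderedRing isOrderedRing public

-- Signs and potentials on bipartite graphs

IsSign : ℤ → Set
IsSign z = z ≡ 1ℤ ⊎ z ≡ -1ℤ

sign-* : ∀ {a b} → IsSign a → IsSign b → IsSign (a ℤ.* b)
sign-* (inj₁ refl) (inj₁ refl) = inj₁ refl
sign-* (inj₁ refl) (inj₂ refl) = inj₂ refl
sign-* (inj₂ refl) (inj₁ refl) = inj₂ refl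
sign-* (inj₂ refl) (inj₂ refl) = inj₁ refl

sign-square : ∀ {a} → IsSign a → a ℤ.* a ≡ 1ℤ
sign-square (inj₁ refl) = refl
sign-square (inj₂ refl) = refl

-- Only the inhabitedness of the index set is extracted: for `Fin 0` the hypothesis is absurd, and
-- the index returned otherwise need not violate `P`.
counterexample : ∀ {n} {P : Fin n → Set} → ¬ (∀ k → P k) → Fin n
counterexample {zero}  ¬P = contradiction (λ ()) ¬P
counterexample {suc n} ¬P = zero

module _ {p q : ℕ} (_∼_ : Fin p → Fin q → Set) where

  -- A switching of the signed graph: multiplying by `lower` and `upper` turns the sign of every
  -- edge positive.
  record Potential (s : Fin p → Fin q → ℤ) : Set where
    field
      lower      : Fin p → ℤ
      upper      : Fin q → ℤ
      lower-sign : ∀ E → IsSign (lower E)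
      upper-sign : ∀ F → IsSign (upper F)
      edge       : ∀ {E F} → E ∼ F → s E F ≡ lower E ℤ.* upper F

  -- Connectedness of a bipartite graph as an induction principle.
  Connected : Set₁
  Connected = ∀ (P : Fin p → Set) (Q : Fin q → Set) →
    (∀ {E F} → E ∼ F → P E → Q F) → (∀ {E F} → E ∼ F → Q F → P E) →
    ∀ F → Q F → (∀ E → P E) × (∀ F → Q F)

-- Inequalities, signs and finite sums in a constructive ordered ring

module OrderedRingProperties (R : OrderedRing) where
  open OrderedRing R renaming (Carrier to C)

  private
    commutativeRing : CommutativeRing 0ℓ 0ℓ
    commutativeRing = record { isCommutativeRing = isCommutativeRing }

  open CommutativeRing commutativeRing
    hiding (Carrier; _≈_; _+_; _*_; -_; 0#; 1#; zero; isCommutativeRing)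
    renaming (refl to ≈-refl; sym to ≈-sym; trans to ≈-trans; reflexive to ≈-reflexive)
  open Algebra.Properties.Ring ring using (-‿involutive; -1*x≈-x)
  open Algebra.Properties.CommutativeSemigroup *-commutativeSemigroup using (x∙yz≈y∙xz)
  private module Σ = Algebra.Properties.Semiring.Sum semiring

  infix 4 _≤_ _≼_

  _≤_ : C → C → Set
  x ≤ y = ¬ y < x

  <-asym : ∀ {x y} → x < y → ¬ y < x
  <-asym x<y y<x = <-irrefl (<-trans x<y y<x)

  ≤-reflexive : ∀ {x y} → x ≈ y → x ≤ y
  ≤-reflexive x≈y y<x = <-irrefl (<-respʳ-≈ x≈y y<x)

  ≤-trans : ∀ {x y z} → x ≤ y → y ≤ z → x ≤ z
  ≤-trans {y = y} x≤y y≤z z<x = [ y≤z , x≤y ] (<-cotrans y z<x)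

  ≤-antisym : ∀ {x y} → x ≤ y → y ≤ x → x ≈ y
  ≤-antisym x≤y y≤x = <-tight y≤x x≤y

  -- By tightness an equality amounts to two negated strict inequalities. This lets equalities leave
  -- the double negation around eigenvectors and maxima.
  ≈-stable : ∀ {x y} → ¬ ¬ x ≈ y → x ≈ y
  ≈-stable ¬¬x≈y = ≤-antisym (λ y<x → ¬¬x≈y λ e → ≤-reflexive e y<x)
                             (λ x<y → ¬¬x≈y λ e → ≤-reflexive (≈-sym e) x<y)

  ≤-poset : Poset 0ℓ 0ℓ 0ℓ
  ≤-poset = record
    { _≤_ = _≤_
    ; isPartialOrder = record
      { isPreorder = record
        { isEquivalence = isEquivalence ; reflexive = ≤-reflexive ; trans = ≤-trans }
      ; antisym = ≤-antisym
      }
    }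

  open Relation.Binary.Reasoning.PartialOrder ≤-poset

  ≤-refl : ∀ {x} → x ≤ x
  ≤-refl = ≤-reflexive ≈-refl

  +-cancelʳ-< : ∀ z {x y} → x + z < y + z → x < y
  +-cancelʳ-< z {x} {y} h = <-respˡ-≈ (undo x) (<-respʳ-≈ (undo y) (+-monoˡ-< (- z) h))
    where
    undo : ∀ a → (a + z) + - z ≈ a
    undo a = ≈-trans (+-assoc a z (- z)) (≈-trans (+-congˡ (-‿inverseʳ z)) (+-identityʳ a))

  +-monoˡ-≤ : ∀ z {x y} → x ≤ y → x + z ≤ y + z
  +-monoˡ-≤ z x≤y = x≤y ∘ +-cancelʳ-< z

  +-mono-≤ : ∀ {x y u v} → x ≤ y → u ≤ v → x + u ≤ y + v
  +-mono-≤ {x} {y} {u} {v} x≤y u≤v = begin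
    x + u   ≤⟨ +-monoˡ-≤ u x≤y ⟩
    y + u   ≈⟨ +-comm y u ⟩
    u + y   ≤⟨ +-monoˡ-≤ y u≤v ⟩
    v + y   ≈⟨ +-comm v y ⟩
    y + v   ∎

  +-cancelʳ-≤ : ∀ z {x y} → x + z ≤ y + z → x ≤ y
  +-cancelʳ-≤ z h = h ∘ +-monoˡ-< z

  -- There is no case distinction on `x ≤ y`. Instead, a failure of the conclusion excludes `x < y`,
  -- so tightness makes `x` and `y` equal, and then the products cannot differ.
  *-monoˡ-≤ : ∀ {z} → 0# < z → ∀ {x y} → x ≤ y → z * x ≤ z * y
  *-monoˡ-≤ 0<z x≤y zy<zx =
    <-irrefl (<-respʳ-≈ (*-congˡ (≤-antisym x≤y (λ x<y → <-asym (*-monoˡ-< 0<z x<y) zy<zx))) zy<zx)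

  *-cancelˡ-≤ : ∀ {z} → 0# < z → ∀ {x y} → z * x ≤ z * y → x ≤ y
  *-cancelˡ-≤ 0<z h = h ∘ *-monoˡ-< 0<z

  *-cancelˡ-≈ : ∀ {z} → 0# < z → ∀ {x y} → z * x ≈ z * y → x ≈ y
  *-cancelˡ-≈ 0<z e = ≤-antisym (*-cancelˡ-≤ 0<z (≤-reflexive e)) (*-cancelˡ-≤ 0<z (≤-reflexive (≈-sym e)))

  0<x⇒-x<0 : ∀ {x} → 0# < x → - x < 0#
  0<x⇒-x<0 {x} 0<x = <-respˡ-≈ (+-identityˡ (- x)) (<-respʳ-≈ (-‿inverseʳ x) (+-monoˡ-< (- x) 0<x))

  1-scale : ∀ x → ⟦ 1ℤ ⟧ * x ≈ x
  1-scale x = ≈-trans (*-congʳ ⟦1⟧) (*-identityˡ x)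

  -1-scale : ∀ x → ⟦ -1ℤ ⟧ * x ≈ - x
  -1-scale x = ≈-trans (*-congʳ ⟦-1⟧) (-1*x≈-x x)

  0-scale : ∀ x → ⟦ 0ℤ ⟧ * x ≈ 0#
  0-scale x = ≈-trans (*-congʳ ⟦0⟧) (zeroˡ x)

  scale-* : ∀ {a b} → IsSign a → IsSign b → ∀ x → ⟦ a ℤ.* b ⟧ * x ≈ ⟦ a ⟧ * (⟦ b ⟧ * x)
  scale-* (inj₁ refl) (inj₁ refl) x = ≈-sym (1-scale _)
  scale-* (inj₁ refl) (inj₂ refl) x = ≈-sym (1-scale _)
  scale-* (inj₂ refl) (inj₁ refl) x = *-congˡ (≈-sym (1-scale x))
  scale-* (inj₂ refl) (inj₂ refl) x = begin-equality
    ⟦ 1ℤ ⟧ * x                 ≈⟨ 1-scale x ⟩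
    x                          ≈⟨ -‿involutive x ⟨
    - - x                      ≈⟨ -1-scale (- x) ⟨
    ⟦ -1ℤ ⟧ * - x              ≈⟨ *-congˡ (-1-scale x) ⟨
    ⟦ -1ℤ ⟧ * (⟦ -1ℤ ⟧ * x)    ∎

  scale-involutive : ∀ {a} → IsSign a → ∀ x → ⟦ a ⟧ * (⟦ a ⟧ * x) ≈ x
  scale-involutive {a} sa x = begin-equality
    ⟦ a ⟧ * (⟦ a ⟧ * x)   ≈⟨ scale-* sa sa x ⟨
    ⟦ a ℤ.* a ⟧ * x       ≡⟨ ≡.cong (λ z → ⟦ z ⟧ * x) (sign-square sa) ⟩
    ⟦ 1ℤ ⟧ * x            ≈⟨ 1-scale x ⟩
    x                     ∎

  scale-transpose : ∀ {a} → IsSign a → ∀ {x y} → ⟦ a ⟧ * x ≈ y → x ≈ ⟦ a ⟧ * y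
  scale-transpose sa e = ≈-trans (≈-sym (scale-involutive sa _)) (*-congˡ e)

  -- Signs can be read off at a positive scale, since `m ≈ - m` would make `m` negative as well.
  scale-injective : ∀ {m} → 0# < m → ∀ {a b} → IsSign a → IsSign b → ⟦ a ⟧ * m ≈ ⟦ b ⟧ * m → a ≡ b
  scale-injective {m} 0<m = cases
    where
    m≉-m : ¬ m ≈ - m
    m≉-m e = <-asym 0<m (<-respˡ-≈ (≈-sym e) (0<x⇒-x<0 0<m))

    cases : ∀ {a b} → IsSign a → IsSign b → ⟦ a ⟧ * m ≈ ⟦ b ⟧ * m → a ≡ b
    cases (inj₁ refl) (inj₁ refl) e = refl
    cases (inj₁ refl) (inj₂ refl) e =
      contradiction (≈-trans (≈-sym (1-scale m)) (≈-trans e (-1-scale m))) m≉-m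
    cases (inj₂ refl) (inj₁ refl) e =
      contradiction (≈-trans (≈-sym (1-scale m)) (≈-trans (≈-sym e) (-1-scale m))) m≉-m
    cases (inj₂ refl) (inj₂ refl) e = refl

  -- x ≼ m says that the absolute value of x is at most m.
  _≼_ : C → C → Set
  x ≼ m = ∀ {ρ} → IsSign ρ → ⟦ ρ ⟧ * x ≤ m

  ≼-intro : ∀ {x m} → x ≤ m → - x ≤ m → x ≼ m
  ≼-intro x≤m -x≤m (inj₁ refl) = ≤-trans (≤-reflexive (1-scale _)) x≤m
  ≼-intro x≤m -x≤m (inj₂ refl) = ≤-trans (≤-reflexive (-1-scale _)) -x≤m

  ≼-weaken : ∀ {x m n} → m ≤ n → x ≼ m → x ≼ n
  ≼-weaken m≤n x≼m sρ = ≤-trans (x≼m sρ) m≤n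

  ≼0⇒≈0 : ∀ {x} → x ≼ 0# → x ≈ 0#
  ≼0⇒≈0 {x} x≼0 = ≤-antisym (≤-trans (≤-reflexive (≈-sym (1-scale x))) (x≼0 (inj₁ refl))) (begin
    0#          ≈⟨ -‿inverseˡ x ⟨
    - x + x     ≤⟨ +-monoˡ-≤ x (≤-trans (≤-reflexive (≈-sym (-1-scale x))) (x≼0 (inj₂ refl))) ⟩
    0# + x      ≈⟨ +-identityˡ x ⟩
    x           ∎)

  private
    sum≈Σ : ∀ {n} (f : Fin n → C) → sum f ≈ Σ.sum f
    sum≈Σ {zero}  f = sum-[] f
    sum≈Σ {suc n} f = ≈-trans (sum-∷ f) (+-congˡ (sum≈Σ (f ∘ suc)))

  sum-cong : ∀ {n} {f g : Fin n → C} → (∀ k → f k ≈ g k) → sum f ≈ sum g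
  sum-cong {f = f} {g} f≈g = ≈-trans (sum≈Σ f) (≈-trans (Σ.sum-cong-≋ f≈g) (≈-sym (sum≈Σ g)))

  ∑-comm : ∀ {m n} (f : Fin m → Fin n → C) → sum (λ i → sum λ j → f i j) ≈ sum λ j → sum λ i → f i j
  ∑-comm f = begin-equality
    sum (λ i → sum (f i))             ≈⟨ sum-cong (λ i → sum≈Σ (f i)) ⟩
    sum (λ i → Σ.sum (f i))           ≈⟨ sum≈Σ (λ i → Σ.sum (f i)) ⟩
    Σ.sum (λ i → Σ.sum (f i))         ≈⟨ Σ.∑-comm f ⟩
    Σ.sum (λ j → Σ.sum λ i → f i j)   ≈⟨ sum≈Σ (λ j → Σ.sum λ i → f i j) ⟨
    sum (λ j → Σ.sum λ i → f i j)     ≈⟨ sum-cong (λ j → sum≈Σ λ i → f i j) ⟨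
    sum (λ j → sum λ i → f i j)       ∎

  *-distribˡ-sum : ∀ {n} x (f : Fin n → C) → x * sum f ≈ sum λ k → x * f k
  *-distribˡ-sum x f =
    ≈-trans (*-congˡ (sum≈Σ f)) (≈-trans (Σ.*-distribˡ-sum x f) (≈-sym (sum≈Σ λ k → x * f k)))

  *-distribʳ-sum : ∀ {n} x (f : Fin n → C) → sum f * x ≈ sum λ k → f k * x
  *-distribʳ-sum x f =
    ≈-trans (*-congʳ (sum≈Σ f)) (≈-trans (Σ.*-distribʳ-sum x f) (≈-sym (sum≈Σ λ k → f k * x)))

  sum-mono-≤ : ∀ {n} {f g : Fin n → C} → (∀ k → f k ≤ g k) → sum f ≤ sum g
  sum-mono-≤ {zero}          f≤g = ≤-reflexive (≈-trans (sum-[] _) (≈-sym (sum-[] _)))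
  sum-mono-≤ {suc n} {f} {g} f≤g = begin
    sum f                    ≈⟨ sum-∷ f ⟩
    f zero + sum (f ∘ suc)   ≤⟨ +-mono-≤ (f≤g zero) (sum-mono-≤ (f≤g ∘ suc)) ⟩
    g zero + sum (g ∘ suc)   ≈⟨ sum-∷ g ⟨
    sum g                    ∎

  -- Replacing the tail of `f` by the larger tail of `g` and cancelling it bounds the head of `g` by
  -- that of `f`; exchanging head and tail feeds the induction. No term has any slack left.
  sum-squeeze : ∀ {n} {f g : Fin n → C} → (∀ k → f k ≤ g k) → sum g ≤ sum f → ∀ k → f k ≈ g k
  sum-squeeze {suc n} {f} {g} f≤g Σg≤Σf = λ
    { zero    → ≤-antisym (f≤g zero) (+-cancelʳ-≤ (sum (g ∘ suc)) (begin
        g zero + sum (g ∘ suc)   ≤⟨ unfolded ⟩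
        f zero + sum (f ∘ suc)   ≤⟨ +-mono-≤ ≤-refl (sum-mono-≤ (f≤g ∘ suc)) ⟩
        f zero + sum (g ∘ suc)   ∎))
    ; (suc k) → sum-squeeze (f≤g ∘ suc) (+-cancelʳ-≤ (g zero) (begin
        sum (g ∘ suc) + g zero   ≈⟨ +-comm _ _ ⟩
        g zero + sum (g ∘ suc)   ≤⟨ unfolded ⟩
        f zero + sum (f ∘ suc)   ≤⟨ +-monoˡ-≤ _ (f≤g zero) ⟩
        g zero + sum (f ∘ suc)   ≈⟨ +-comm _ _ ⟩
        sum (f ∘ suc) + g zero   ∎)) k
    }
    where
    unfolded : g zero + sum (g ∘ suc) ≤ f zero + sum (f ∘ suc)
    unfolded = begin
      g zero + sum (g ∘ suc)   ≈⟨ sum-∷ g ⟨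
      sum g                    ≤⟨ Σg≤Σf ⟩
      sum f                    ≈⟨ sum-∷ f ⟩
      f zero + sum (f ∘ suc)   ∎

  sum-zero : ∀ {n} {f : Fin n → C} → (∀ k → f k ≈ 0#) → sum f ≈ 0#
  sum-zero {n} f≈0 = ≈-trans (sum-cong f≈0) (≈-trans (sum≈Σ _) (Σ.sum-replicate-zero n))

  sum-nonneg : ∀ {n} {f : Fin n → C} → (∀ k → 0# ≤ f k) → 0# ≤ sum f
  sum-nonneg {n} 0≤f = ≤-trans (≤-reflexive (≈-sym (sum-zero {n} λ _ → ≈-refl))) (sum-mono-≤ 0≤f)

  nonneg-sum-zero : ∀ {n} {f : Fin n → C} → (∀ k → 0# ≤ f k) → sum f ≈ 0# → ∀ k → f k ≈ 0#
  nonneg-sum-zero {n} 0≤f Σf≈0 k =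
    ≈-sym (sum-squeeze 0≤f (≤-reflexive (≈-trans Σf≈0 (≈-sym (sum-zero {n} λ _ → ≈-refl)))) k)

  -- Associativity of a matrix product applied to a vector, for a single row `a`.
  sum-assoc : ∀ {m n} (a : Fin m → C) (b : Fin m → Fin n → C) (c : Fin n → C) →
              sum (λ k → sum (λ j → a j * b j k) * c k) ≈ sum λ j → a j * sum λ k → b j k * c k
  sum-assoc {m} {n} a b c = begin-equality
    sum (λ k → sum (λ j → a j * b j k) * c k)
      ≈⟨ sum-cong (λ k → *-distribʳ-sum (c k) λ j → a j * b j k) ⟩
    sum (λ k → sum λ j → a j * b j k * c k)
      ≈⟨ ∑-comm (λ k j → a j * b j k * c k) ⟩
    sum (λ j → sum λ k → a j * b j k * c k)
      ≈⟨ sum-cong (λ j → sum-cong λ k → *-assoc (a j) (b j k) (c k)) ⟩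
    sum (λ j → sum λ k → a j * (b j k * c k))
      ≈⟨ sum-cong (λ j → *-distribˡ-sum (a j) λ k → b j k * c k) ⟨
    sum (λ j → a j * sum λ k → b j k * c k) ∎

  diagonal : ∀ {n} → (Fin n → C) → Fin n → Fin n → C
  diagonal d i j = if ⌊ i Fin.≟ j ⌋ then d i else 0#

  sum-diag : ∀ {n} (i : Fin n) (d f : Fin n → C) →
             sum (λ j → diagonal d i j * f j) ≈ d i * f i
  sum-diag {suc n} zero d f = ≈-trans (sum-∷ _) (≈-trans (+-congˡ (sum-zero λ j → zeroˡ (f (suc j)))) (+-identityʳ _))
  sum-diag {suc n} (suc i) d f = ≈-trans (sum-∷ _) (≈-trans (+-congʳ (zeroˡ (f zero)))
    (≈-trans (+-identityˡ _) (≈-trans (sum-cong step) (sum-diag i (d ∘ suc) (f ∘ suc)))))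
    where
    step : ∀ j → (if ⌊ suc i Fin.≟ suc j ⌋ then d (suc i) else 0#) * f (suc j) ≈
                 (if ⌊ i Fin.≟ j ⌋ then d (suc i) else 0#) * f (suc j)
    step j with i Fin.≟ j
    ... | yes _ = ≈-refl
    ... | no _  = ≈-refl

  IsEigenvalue : ∀ {n} → (Fin n → Fin n → C) → C → Set
  IsEigenvalue {n} A μ = ¬ ¬ (∃ λ (v : Fin n → C) → (¬ (∀ i → v i ≈ 0#)) × (∀ i → sum (λ j → A i j * v j) ≈ μ * v i))

  module _ {n} {P : Fin n → Set} (P? : ∀ k → Dec (P k)) where

    restrict-nonneg : ∀ {f : Fin n → C} → (∀ k → 0# ≤ f k) → ∀ k → 0# ≤ (if ⌊ P? k ⌋ then f k else 0#)
    restrict-nonneg 0≤f k with P? k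
    ... | yes _ = 0≤f k
    ... | no _  = ≤-refl

    restrict-sum-* : ∀ (f : Fin n → C) c →
      sum (λ k → if ⌊ P? k ⌋ then f k else 0#) * c ≈ sum λ k → if ⌊ P? k ⌋ then f k * c else 0#
    restrict-sum-* f c = ≈-trans (*-distribʳ-sum c λ k → if ⌊ P? k ⌋ then f k else 0#) (sum-cong step)
      where
      step : ∀ k → (if ⌊ P? k ⌋ then f k else 0#) * c ≈ (if ⌊ P? k ⌋ then f k * c else 0#)
      step k with P? k
      ... | yes _ = ≈-refl
      ... | no _  = zeroˡ c

    restrict-sum-cong : ∀ {f g : Fin n → C} → (∀ k → f k ≈ g k) →
      sum (λ k → if ⌊ P? k ⌋ then f k else 0#) ≈ sum λ k → if ⌊ P? k ⌋ then g k else 0#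
    restrict-sum-cong {f} {g} f≈g = sum-cong step
      where
      step : ∀ k → (if ⌊ P? k ⌋ then f k else 0#) ≈ (if ⌊ P? k ⌋ then g k else 0#)
      step k with P? k
      ... | yes _ = f≈g k
      ... | no _  = ≈-refl

  -- Triangle inequality for a sum with signed positive coefficients, its
  -- equality case and the converse of the latter.

  module SignedSum {n} {P : Fin n → Set} (P? : ∀ k → Dec (P k))
    (s : Fin n → ℤ) (s-sign : ∀ {k} → P k → IsSign (s k)) (s-zero : ∀ {k} → ¬ P k → s k ≡ 0ℤ)
    (w : Fin n → C) (0<w : ∀ k → 0# < w k) where

    signedSum : (Fin n → C) → C
    signedSum x = sum λ k → ⟦ s k ⟧ * (w k * x k)

    majorant : (Fin n → C) → C
    majorant m = sum λ k → if ⌊ P? k ⌋ then w k * m k else 0#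

    signedSum-cong : ∀ {x y} → (∀ k → x k ≈ y k) → signedSum x ≈ signedSum y
    signedSum-cong x≈y = sum-cong λ k → *-congˡ (*-congˡ (x≈y k))

    signedSum-scale : ∀ c x → signedSum (λ k → c * x k) ≈ c * signedSum x
    signedSum-scale c x = ≈-trans
      (sum-cong λ k → ≈-trans (*-congˡ (x∙yz≈y∙xz (w k) c (x k))) (x∙yz≈y∙xz ⟦ s k ⟧ c (w k * x k)))
      (≈-sym (*-distribˡ-sum c λ k → ⟦ s k ⟧ * (w k * x k)))

    private
      rearrange : ∀ a b c d → a * (b * (c * d)) ≈ c * (a * (b * d))
      rearrange a b c d = ≈-trans (*-congˡ (x∙yz≈y∙xz b c d)) (x∙yz≈y∙xz a c (b * d))

    module _ {x m : Fin n → C} where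

      term-≤ : (∀ k → x k ≼ m k) → ∀ {ρ} → IsSign ρ → ∀ k →
               ⟦ ρ ⟧ * (⟦ s k ⟧ * (w k * x k)) ≤ (if ⌊ P? k ⌋ then w k * m k else 0#)
      term-≤ x≼m {ρ} sρ k with P? k
      ... | yes p = begin
        ⟦ ρ ⟧ * (⟦ s k ⟧ * (w k * x k))   ≈⟨ rearrange _ _ _ _ ⟩
        w k * (⟦ ρ ⟧ * (⟦ s k ⟧ * x k))   ≈⟨ *-congˡ (scale-* sρ (s-sign p) (x k)) ⟨
        w k * (⟦ ρ ℤ.* s k ⟧ * x k)       ≤⟨ *-monoˡ-≤ (0<w k) (x≼m k (sign-* sρ (s-sign p))) ⟩
        w k * m k                         ∎
      ... | no ¬p = ≤-reflexive (≈-trans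
        (*-congˡ (≈-trans (*-congʳ (≈-reflexive (≡.cong ⟦_⟧ (s-zero ¬p)))) (0-scale _))) (zeroʳ _))

      signedSum-≼ : (∀ k → x k ≼ m k) → signedSum x ≼ majorant m
      signedSum-≼ x≼m {ρ} sρ = ≤-trans (≤-reflexive (*-distribˡ-sum ⟦ ρ ⟧ λ k → ⟦ s k ⟧ * (w k * x k)))
        (sum-mono-≤ (term-≤ x≼m sρ))

      signedSum-squeeze : (∀ k → x k ≼ m k) → ∀ {ρ} → IsSign ρ → majorant m ≤ ⟦ ρ ⟧ * signedSum x →
                          ∀ {k} → P k → ⟦ ρ ⟧ * (⟦ s k ⟧ * x k) ≈ m k
      -- Abstracting over `P? k` together with the termwise equality reduces the `if` in its type;
      -- the positive weight then cancels.
      signedSum-squeeze x≼m {ρ} sρ h {k} p with P? k | sum-squeeze (term-≤ x≼m sρ)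
        (≤-trans h (≤-reflexive (*-distribˡ-sum ⟦ ρ ⟧ λ k → ⟦ s k ⟧ * (w k * x k)))) k
      ... | yes _ | e = *-cancelˡ-≈ (0<w k) (≈-trans (≈-sym (rearrange _ _ _ _)) e)
      ... | no ¬p | _ = contradiction p ¬p

      signedSum-aligned : ∀ {ρ} → (∀ {k} → P k → ⟦ s k ⟧ * x k ≈ ⟦ ρ ⟧ * m k) →
                          signedSum x ≈ ⟦ ρ ⟧ * majorant m
      signedSum-aligned {ρ} aligned = ≈-trans (sum-cong term)
        (≈-sym (*-distribˡ-sum ⟦ ρ ⟧ λ k → if ⌊ P? k ⌋ then w k * m k else 0#))
        where
        term : ∀ k → ⟦ s k ⟧ * (w k * x k) ≈ ⟦ ρ ⟧ * (if ⌊ P? k ⌋ then w k * m k else 0#)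
        term k with P? k
        ... | yes p = ≈-trans (x∙yz≈y∙xz _ _ _) (≈-trans (*-congˡ (aligned p)) (x∙yz≈y∙xz _ _ _))
        ... | no ¬p = ≈-trans (*-congʳ (≈-reflexive (≡.cong ⟦_⟧ (s-zero ¬p))))
                        (≈-trans (0-scale _) (≈-sym (zeroʳ _)))

  -- Over a constructive ordered ring a maximum is attained only up to double negation.

  Attained : ∀ {n} → (Fin n → C) → C → Set
  Attained x m = ∃[ k ] ∃[ τ ] (IsSign τ × x k ≈ ⟦ τ ⟧ * m)

  private
    -- The running maximum of absolute values starts at `0#`. The alternative `m ≈ 0#` covers the
    -- case that no entry has exceeded it, in particular the empty index set. Comparing both `x₀`
    -- and `- x₀` with `m` determines the sign at the new maximum.
    supremum : ∀ {n} (x : Fin n → C) →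
      ¬ ¬ (∃[ m ] (0# ≤ m × (m ≈ 0# ⊎ Attained x m) × (∀ k → x k ≼ m)))
    supremum {zero}  x found = found (0# , ≤-refl , inj₁ ≈-refl , λ ())
    supremum {suc n} x found = supremum (x ∘ suc) λ (m , 0≤m , attained , tail≼m) →
      let x₀ = x zero
          0≤ : ∀ {a} → m < a → 0# ≤ a
          0≤ m<a = ≤-trans 0≤m (<-asym m<a)
      in
      ¬¬-excluded-middle {A = m < x₀} λ
      { (yes m<x₀) → found (x₀ , 0≤ m<x₀ , inj₂ (zero , 1ℤ , inj₁ refl , ≈-sym (1-scale x₀)) , λ
          { zero {ρ}    → ≼-intro ≤-refl (≤-trans (-a≤0 (0≤ m<x₀)) (0≤ m<x₀)) {ρ}
          ; (suc k) {ρ} → ≼-weaken (<-asym m<x₀) (λ {ρ} → tail≼m k {ρ}) {ρ} })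
      ; (no x₀≤m) → ¬¬-excluded-middle {A = m < - x₀} λ
        { (yes m<-x₀) → found (- x₀ , 0≤ m<-x₀
            , inj₂ (zero , -1ℤ , inj₂ refl , ≈-sym (≈-trans (-1-scale (- x₀)) (-‿involutive x₀))) , λ
            { zero {ρ}    → ≼-intro (≤-trans (≤-reflexive (≈-sym (-‿involutive x₀)))
                                   (≤-trans (-a≤0 (0≤ m<-x₀)) (0≤ m<-x₀))) ≤-refl {ρ}
            ; (suc k) {ρ} → ≼-weaken (<-asym m<-x₀) (λ {ρ} → tail≼m k {ρ}) {ρ} })
        ; (no -x₀≤m) → found (m , 0≤m , Sum.map₂ (λ (k , rest) → suc k , rest) attained , λ
            { zero {ρ}    → ≼-intro x₀≤m -x₀≤m {ρ}
            ; (suc k) {ρ} → tail≼m k {ρ} })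
        }
      }
      where
      -a≤0 : ∀ {a} → 0# ≤ a → - a ≤ 0#
      -a≤0 {a} 0≤a = begin
        - a        ≈⟨ +-identityˡ (- a) ⟨
        0# + - a   ≤⟨ +-monoˡ-≤ (- a) 0≤a ⟩
        a + - a    ≈⟨ -‿inverseʳ a ⟩
        0#         ∎

  -- A supremum that is not positive bounds all absolute values by zero, so every entry would
  -- vanish. Positivity is what allows `m` to be cancelled later.
  positive-supremum : ∀ {n} (x : Fin n → C) → ¬ (∀ k → x k ≈ 0#) →
    ¬ ¬ (∃[ m ] (0# < m × Attained x m × (∀ k → x k ≼ m)))
  positive-supremum x x≉0 found = supremum x λ
    { (m , 0≤m , inj₁ m≈0 , x≼m)      → x≉0 λ k → ≼0⇒≈0 (≼-weaken (≤-reflexive m≈0) (λ {ρ} → x≼m k {ρ}))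
    ; (m , 0≤m , inj₂ attained , x≼m) → x≉0 λ k →
        ≼0⇒≈0 (≼-weaken (λ 0<m → found (m , 0<m , attained , x≼m)) (λ {ρ} → x≼m k {ρ}))
    }

  -- A weighted signed bipartite graph with vertex classes Fin p and Fin q, and
  -- the operator W⁻¹ Dᵀ W′ D, for W⁻¹ = diag r, W′ = diag w and D = (s E F)ᵀ.

  module Laplacian {p q} {_∼_ : Fin p → Fin q → Set} (_∼?_ : ∀ E F → Dec (E ∼ F))
    (s : Fin p → Fin q → ℤ)
    (s-sign : ∀ {E F} → E ∼ F → IsSign (s E F)) (s-zero : ∀ {E F} → ¬ E ∼ F → s E F ≡ 0ℤ)
    (r : Fin p → C) (0<r : ∀ E → 0# < r E) (w : Fin q → C) (0<w : ∀ F → 0# < w F)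
    where

    module Lower E = SignedSum (E ∼?_) (s E) s-sign s-zero w 0<w
    module Upper F = SignedSum (_∼? F) (λ E → s E F) s-sign s-zero r 0<r

    ∇ : (Fin p → C) → Fin q → C
    ∇ v F = sum λ E → ⟦ s E F ⟧ * v E

    -- The adjoint of `∇` for the inner products with weights `1 / r` and `w`. Since `r` is also the
    -- weight in `Upper`, `∇ (∇* x) F` is by definition `Upper.signedSum F` of the family of
    -- `Lower.signedSum E x`, so that the two triangle inequalities compose.
    ∇* : (Fin q → C) → Fin p → C
    ∇* u E = r E * Lower.signedSum E u

    degree : Fin p → C
    degree E = sum λ F → if ⌊ E ∼? F ⌋ then w F else 0#

    -- With `r E` the reciprocal of `w(E)` this is the sum of `deg E / w(E)` over the facets of `F`.
    rowSum : Fin q → C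
    rowSum F = sum λ E → if ⌊ E ∼? F ⌋ then degree E * r E else 0#

    IsEigenvector : C → (Fin p → C) → Set
    IsEigenvector μ v = ∀ E → ∇* (∇ v) E ≈ μ * v E

    degree-majorant : ∀ E m → Lower.majorant E (λ _ → m) ≈ degree E * m
    degree-majorant E m = ≈-sym (restrict-sum-* (E ∼?_) w m)

    rowSum-majorant : ∀ F m → Upper.majorant F (λ E → degree E * m) ≈ rowSum F * m
    rowSum-majorant F m = ≈-trans
      (restrict-sum-cong (_∼? F) λ E → ≈-trans (≈-sym (*-assoc (r E) (degree E) m)) (*-congʳ (*-comm (r E) (degree E))))
      (≈-sym (restrict-sum-* (_∼? F) (λ E → degree E * r E) m))

    degree-nonneg : ∀ E → 0# ≤ degree E
    degree-nonneg E = sum-nonneg (restrict-nonneg (E ∼?_) λ F → <-asym (0<w F))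

    degree*r-nonneg : ∀ E → 0# ≤ degree E * r E
    degree*r-nonneg E = begin
      0#             ≈⟨ zeroʳ (r E) ⟨
      r E * 0#       ≤⟨ *-monoˡ-≤ (0<r E) (degree-nonneg E) ⟩
      r E * degree E ≈⟨ *-comm (r E) (degree E) ⟩
      degree E * r E ∎

    rowSum-nonneg : ∀ F → 0# ≤ rowSum F
    rowSum-nonneg F = sum-nonneg (restrict-nonneg (_∼? F) degree*r-nonneg)

    degree≉0 : ∀ {E F} → E ∼ F → ¬ degree E ≈ 0#
    degree≉0 {E} {F} E∼F deg≈0
      with E ∼? F | nonneg-sum-zero (restrict-nonneg (E ∼?_) λ F → <-asym (0<w F)) deg≈0 F
    ... | yes _ | wF≈0 = <-irrefl (<-respʳ-≈ wF≈0 (0<w F))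
    ... | no ¬E∼F | _  = ¬E∼F E∼F

    rowSum≉0 : ∀ {E F} → E ∼ F → ¬ rowSum F ≈ 0#
    rowSum≉0 {E} {F} E∼F row≈0
      with E ∼? F | nonneg-sum-zero (restrict-nonneg (_∼? F) degree*r-nonneg) row≈0 E
    ... | yes _ | e = degree≉0 E∼F (*-cancelˡ-≈ (0<r E)
                        (≈-trans (*-comm (r E) (degree E)) (≈-trans e (≈-sym (zeroʳ (r E))))))
    ... | no ¬E∼F | _ = ¬E∼F E∼F

    ∇-eigen : ∀ {μ v} → IsEigenvector μ v → ∀ F → ∇ (∇* (∇ v)) F ≈ μ * ∇ v F
    ∇-eigen {μ} {v} eigen F = begin-equality
      sum (λ E → ⟦ s E F ⟧ * ∇* (∇ v) E)     ≈⟨ sum-cong (λ E → *-congˡ (eigen E)) ⟩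
      sum (λ E → ⟦ s E F ⟧ * (μ * v E))      ≈⟨ sum-cong (λ E → x∙yz≈y∙xz ⟦ s E F ⟧ μ (v E)) ⟩
      sum (λ E → μ * (⟦ s E F ⟧ * v E))      ≈⟨ *-distribˡ-sum μ (λ E → ⟦ s E F ⟧ * v E) ⟨
      μ * ∇ v F                              ∎

    -- If `∇ v` vanished, so would `μ * v`, and a positive `μ` cancels. The weaker `¬ μ ≤ 0#` is
    -- enough because the conclusion is a negation.
    ∇≉0 : ∀ {μ v} → IsEigenvector μ v → ¬ (∀ E → v E ≈ 0#) → ¬ μ ≤ 0# → ¬ (∀ F → ∇ v F ≈ 0#)
    ∇≉0 {μ} {v} eigen v≉0 μ≰0 ∇v≈0 = μ≰0 λ 0<μ → v≉0 λ E → *-cancelˡ-≈ 0<μ (begin-equality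
      μ * v E                                ≈⟨ eigen E ⟨
      r E * Lower.signedSum E (∇ v)          ≈⟨ *-congˡ (sum-zero λ F → ≈-trans (*-congˡ
                                                  (≈-trans (*-congˡ (∇v≈0 F)) (zeroʳ (w F)))) (zeroʳ ⟦ s E F ⟧)) ⟩
      r E * 0#                               ≈⟨ zeroʳ (r E) ⟩
      0#                                     ≈⟨ zeroʳ μ ⟨
      μ * 0#                                 ∎)

    module Extremal {x : Fin q → C} {m μ} (0<m : 0# < m) (x≼m : ∀ F → x F ≼ m)
      (eigen : ∀ F → ∇ (∇* x) F ≈ μ * x F) where

      lower-≼ : ∀ E → Lower.signedSum E x ≼ degree E * m
      lower-≼ E = ≼-weaken (≤-reflexive (degree-majorant E m))
        (λ {ρ} → Lower.signedSum-≼ E (λ F {ρ} → x≼m F {ρ}) {ρ})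

      extremal-value : ∀ {F τ} → IsSign τ → x F ≈ ⟦ τ ⟧ * m → ⟦ τ ⟧ * ∇ (∇* x) F ≈ μ * m
      extremal-value {F} {τ} sτ e = begin-equality
        ⟦ τ ⟧ * ∇ (∇* x) F          ≈⟨ *-congˡ (eigen F) ⟩
        ⟦ τ ⟧ * (μ * x F)           ≈⟨ *-congˡ (*-congˡ e) ⟩
        ⟦ τ ⟧ * (μ * (⟦ τ ⟧ * m))   ≈⟨ *-congˡ (x∙yz≈y∙xz μ ⟦ τ ⟧ m) ⟩
        ⟦ τ ⟧ * (⟦ τ ⟧ * (μ * m))   ≈⟨ scale-involutive sτ (μ * m) ⟩
        μ * m                       ∎

      μ≤rowSum : ∀ {F τ} → IsSign τ → x F ≈ ⟦ τ ⟧ * m → μ ≤ rowSum F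
      μ≤rowSum {F} {τ} sτ e = *-cancelˡ-≤ 0<m (begin
        m * μ                                      ≈⟨ *-comm m μ ⟩
        μ * m                                      ≈⟨ extremal-value sτ e ⟨
        ⟦ τ ⟧ * ∇ (∇* x) F                         ≤⟨ Upper.signedSum-≼ F (λ E {ρ} → lower-≼ E {ρ}) sτ ⟩
        Upper.majorant F (λ E → degree E * m)      ≈⟨ rowSum-majorant F m ⟩
        rowSum F * m                               ≈⟨ *-comm (rowSum F) m ⟩
        m * rowSum F                               ∎)

      -- Equality in both triangle inequalities behind μ≤rowSum.
      neighbour-extremal : ∀ {F τ} → IsSign τ → x F ≈ ⟦ τ ⟧ * m → rowSum F ≤ μ →
        ∀ {E} → E ∼ F → ∀ {F′} → E ∼ F′ → ⟦ s E F′ ⟧ * x F′ ≈ ⟦ τ ℤ.* s E F ⟧ * m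
      neighbour-extremal {F} {τ} sτ e row≤μ {E} E∼F {F′} E∼F′ =
        -- Equality in the outer sum gives `Lower.signedSum E x` the largest absolute value that the
        -- inner inequality permits, so every term of the inner sum is extremal in its turn.
        scale-transpose sρ (Lower.signedSum-squeeze E (λ F {ρ} → x≼m F {ρ}) sρ
          (≤-reflexive (begin-equality
            Lower.majorant E (λ _ → m)                        ≈⟨ degree-majorant E m ⟩
            degree E * m                                      ≈⟨ outer E∼F ⟨
            ⟦ τ ⟧ * (⟦ s E F ⟧ * Lower.signedSum E x)         ≈⟨ scale-* sτ (s-sign E∼F) _ ⟨
            ⟦ τ ℤ.* s E F ⟧ * Lower.signedSum E x             ∎)) E∼F′)
        where
        sρ = sign-* sτ (s-sign E∼F)
        outer = Upper.signedSum-squeeze F (λ E {ρ} → lower-≼ E {ρ}) sτ (begin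
          Upper.majorant F (λ E → degree E * m)   ≈⟨ rowSum-majorant F m ⟩
          rowSum F * m                            ≈⟨ *-comm (rowSum F) m ⟩
          m * rowSum F                            ≤⟨ *-monoˡ-≤ 0<m row≤μ ⟩
          m * μ                                   ≈⟨ *-comm m μ ⟩
          μ * m                                   ≈⟨ extremal-value sτ e ⟨
          ⟦ τ ⟧ * ∇ (∇* x) F                      ∎)

      -- A single sign `σ` serves all cofaces of `E`: the terms of the inner sum are aligned. This
      -- is what carries extremality from one coface of `E` to the others.
      LowerExtremal : Fin p → Set
      LowerExtremal E = ∃[ σ ] (IsSign σ × (∀ {F} → E ∼ F → ⟦ s E F ⟧ * x F ≈ ⟦ σ ⟧ * m))

      UpperExtremal : Fin q → Set
      UpperExtremal F = ∃[ τ ] (IsSign τ × x F ≈ ⟦ τ ⟧ * m)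

      upper⇒lower : ∀ {E F} → rowSum F ≤ μ → E ∼ F → UpperExtremal F → LowerExtremal E
      upper⇒lower {E} {F} row≤μ E∼F (τ , sτ , e) =
        τ ℤ.* s E F , sign-* sτ (s-sign E∼F) , λ E∼F′ → neighbour-extremal sτ e row≤μ E∼F E∼F′

      lower⇒upper : ∀ {E F} → E ∼ F → LowerExtremal E → UpperExtremal F
      lower⇒upper {E} {F} E∼F (σ , sσ , e) =
        s E F ℤ.* σ , sign-* (s-sign E∼F) sσ ,
        ≈-trans (scale-transpose (s-sign E∼F) (e E∼F)) (≈-sym (scale-* (s-sign E∼F) sσ m))

      -- The value `x F` is `τ` times `m`, and `s E F` times it is `σ` times `m`. Hence `s E F` and
      -- the product of `σ` and `τ` agree on the positive `m`.
      extremal-signs : ∀ {E F} → E ∼ F → (l : LowerExtremal E) (u : UpperExtremal F) →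
                       s E F ≡ proj₁ l ℤ.* proj₁ u
      extremal-signs {E} {F} E∼F (σ , sσ , eσ) (τ , sτ , eτ) =
        scale-injective 0<m (s-sign E∼F) (sign-* sσ sτ) (begin-equality
          ⟦ s E F ⟧ * m                    ≈⟨ *-congˡ (scale-involutive sτ m) ⟨
          ⟦ s E F ⟧ * (⟦ τ ⟧ * (⟦ τ ⟧ * m)) ≈⟨ *-congˡ (*-congˡ eτ) ⟨
          ⟦ s E F ⟧ * (⟦ τ ⟧ * x F)        ≈⟨ x∙yz≈y∙xz ⟦ s E F ⟧ ⟦ τ ⟧ (x F) ⟩
          ⟦ τ ⟧ * (⟦ s E F ⟧ * x F)        ≈⟨ *-congˡ (eσ E∼F) ⟩
          ⟦ τ ⟧ * (⟦ σ ⟧ * m)              ≈⟨ x∙yz≈y∙xz ⟦ τ ⟧ ⟦ σ ⟧ m ⟩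
          ⟦ σ ⟧ * (⟦ τ ⟧ * m)              ≈⟨ scale-* sσ sτ m ⟨
          ⟦ σ ℤ.* τ ⟧ * m                  ∎)

      rowSum≈μ : ∀ {F} → rowSum F ≤ μ → UpperExtremal F → rowSum F ≈ μ
      rowSum≈μ row≤μ (τ , sτ , e) = ≤-antisym row≤μ (μ≤rowSum sτ e)

    eigenvalue-≤ : ∀ {c μ v} → Fin q → (∀ F → rowSum F ≤ c) →
                   ¬ (∀ E → v E ≈ 0#) → IsEigenvector μ v → μ ≤ c
    eigenvalue-≤ {c} {μ} {v} F₀ rowSum≤c v≉0 eigen c<μ = positive-supremum (∇ v)
      -- Under the assumption `c < μ` the eigenvalue cannot be nonpositive, because `c` bounds the
      -- nonnegative row sum at `F₀`.
      (∇≉0 eigen v≉0 λ μ≤0 → ≤-trans (≤-trans μ≤0 (rowSum-nonneg F₀)) (rowSum≤c F₀) c<μ)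
      λ { (m , 0<m , (F , τ , sτ , e) , x≼m) →
            ≤-trans (Extremal.μ≤rowSum 0<m (λ F {ρ} → x≼m F {ρ}) (∇-eigen eigen) sτ e) (rowSum≤c F) c<μ }

    module Aligned (σ : Fin p → ℤ) (τ : Fin q → ℤ) (σ-sign : ∀ E → IsSign (σ E)) (τ-sign : ∀ F → IsSign (τ F))
      (aligned : ∀ {E F} → E ∼ F → s E F ≡ σ E ℤ.* τ F) {c} (rowSum≈c : ∀ F → rowSum F ≈ c) where

      -- The all-ones vector switched by `τ`. Once `∇ (∇* u)` is `c` times `u`, applying `∇*` shows
      -- that `v` is an eigenvector of `∇*` after `∇`.
      u : Fin q → C
      u F = ⟦ τ F ⟧ * 1#

      v : Fin p → C
      v = ∇* u

      s-τ : ∀ {E F} → E ∼ F → ∀ y → ⟦ s E F ⟧ * (⟦ τ F ⟧ * y) ≈ ⟦ σ E ⟧ * y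
      s-τ {E} {F} E∼F y = begin-equality
        ⟦ s E F ⟧ * (⟦ τ F ⟧ * y)               ≡⟨ ≡.cong (λ z → ⟦ z ⟧ * (⟦ τ F ⟧ * y)) (aligned E∼F) ⟩
        ⟦ σ E ℤ.* τ F ⟧ * (⟦ τ F ⟧ * y)         ≈⟨ scale-* (σ-sign E) (τ-sign F) _ ⟩
        ⟦ σ E ⟧ * (⟦ τ F ⟧ * (⟦ τ F ⟧ * y))     ≈⟨ *-congˡ (scale-involutive (τ-sign F) y) ⟩
        ⟦ σ E ⟧ * y                             ∎

      lower-u : ∀ E → Lower.signedSum E u ≈ ⟦ σ E ⟧ * (degree E * 1#)
      lower-u E = ≈-trans (Lower.signedSum-aligned E λ E∼F → s-τ E∼F 1#) (*-congˡ (degree-majorant E 1#))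

      ∇v : ∀ F → ∇ v F ≈ c * u F
      ∇v F = begin-equality
        Upper.signedSum F (λ E → Lower.signedSum E u)
          ≈⟨ Upper.signedSum-cong F lower-u ⟩
        Upper.signedSum F (λ E → ⟦ σ E ⟧ * (degree E * 1#))
          ≈⟨ Upper.signedSum-aligned F (λ {E} E∼F → s-σ E∼F (degree E * 1#)) ⟩
        ⟦ τ F ⟧ * Upper.majorant F (λ E → degree E * 1#)
          ≈⟨ *-congˡ (≈-trans (rowSum-majorant F 1#) (*-congʳ (rowSum≈c F))) ⟩
        ⟦ τ F ⟧ * (c * 1#)
          ≈⟨ x∙yz≈y∙xz ⟦ τ F ⟧ c 1# ⟩
        c * u F ∎
        where
        s-σ : ∀ {E} → E ∼ F → ∀ y → ⟦ s E F ⟧ * (⟦ σ E ⟧ * y) ≈ ⟦ τ F ⟧ * y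
        s-σ {E} E∼F y = ≈-sym (scale-transpose (s-sign E∼F) (s-τ E∼F y))

      v-eigen : IsEigenvector c v
      v-eigen E = begin-equality
        r E * Lower.signedSum E (∇ v)               ≈⟨ *-congˡ (Lower.signedSum-cong E ∇v) ⟩
        r E * Lower.signedSum E (λ F → c * u F)     ≈⟨ *-congˡ (Lower.signedSum-scale E c u) ⟩
        r E * (c * Lower.signedSum E u)             ≈⟨ x∙yz≈y∙xz (r E) c _ ⟩
        c * v E                                     ∎

      v≉0 : ∀ {E F} → E ∼ F → ¬ (∀ E → v E ≈ 0#)
      v≉0 {E} E∼F v≈0 = degree≉0 E∼F (begin-equality
        degree E                ≈⟨ *-identityʳ (degree E) ⟨
        degree E * 1#           ≈⟨ scale-transpose (σ-sign E) (≈-trans (≈-sym (lower-u E))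
                                     (*-cancelˡ-≈ (0<r E) (≈-trans (v≈0 E) (≈-sym (zeroʳ (r E)))))) ⟩
        ⟦ σ E ⟧ * 0#            ≈⟨ zeroʳ ⟦ σ E ⟧ ⟩
        0#                      ∎)

    -- The matrix enters only through its action on vectors and the row sums only up to `≈`, so
    -- neither is unfolded for the reals. Here `c` is any upper bound of `T`, not yet a maximum.
    module Spectrum {𝓛 : Fin p → Fin p → C}
      (apply : ∀ (v : Fin p → C) (E : Fin p) → sum (λ j → 𝓛 E j * v j) ≈
                       r E * sum λ F → ⟦ s E F ⟧ * (w F * sum λ j → ⟦ s j F ⟧ * v j))
      {T : Fin q → C}
      (rowSum≈T : ∀ (F : Fin q) → sum (λ E → if ⌊ E ∼? F ⌋ then
                              sum (λ G → if ⌊ E ∼? G ⌋ then w G else 0#) * r E else 0#) ≈ T F)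
      {c : C} (T≤c : ∀ (F : Fin q) → T F ≤ c) where

      eigenvector : ∀ {μ v} → (∀ E → sum (λ j → 𝓛 E j * v j) ≈ μ * v E) → IsEigenvector μ v
      eigenvector {v = v} eigen E = ≈-trans (≈-sym (apply v E)) (eigen E)

      rowSum≤c : ∀ F → rowSum F ≤ c
      rowSum≤c F = ≤-trans (≤-reflexive (rowSum≈T F)) (T≤c F)

      largest-≤ : Fin q → ∀ {μ} → IsEigenvalue 𝓛 μ → μ ≤ c
      largest-≤ F₀ isEigenvalue c<μ = isEigenvalue λ (v , v≉0 , eigen) →
        eigenvalue-≤ F₀ rowSum≤c v≉0 (eigenvector eigen) c<μ

      module _ (connected : Connected _∼_) (coface : ∀ E → ∃[ F ] E ∼ F) where

        equality⇒ : ∀ {μ} → IsEigenvalue 𝓛 μ → μ ≈ c → ¬ ¬ (Potential _∼_ s × (∀ F → rowSum F ≈ μ))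
        equality⇒ {μ} isEigenvalue μ≈c goal = isEigenvalue λ (v , v≉0 , eigen) →
          -- A nonzero eigenvector guarantees that some `E` exists. The row sum of a coface of `E`
          -- is nonzero and at most `μ`, so `μ` is not nonpositive.
          let F , E∼F = coface (counterexample v≉0)
              ev = eigenvector {v = v} eigen
          in positive-supremum (∇ v)
               (∇≉0 ev v≉0 λ μ≤0 → rowSum≉0 E∼F (≤-antisym (≤-trans (rowSum≤μ F) μ≤0) (rowSum-nonneg F)))
               λ (m , 0<m , (F₀ , extremal) , ∇v≼m) →
                 let open Extremal 0<m (λ F {ρ} → ∇v≼m F {ρ}) (∇-eigen ev)
                     lower , upper = connected LowerExtremal UpperExtremal lower⇒upper
                                       (λ {_} {F} → upper⇒lower (rowSum≤μ F)) F₀ extremal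
                 in goal (record
                      { lower      = proj₁ ∘ lower
                      ; upper      = proj₁ ∘ upper
                      ; lower-sign = proj₁ ∘ proj₂ ∘ lower
                      ; upper-sign = proj₁ ∘ proj₂ ∘ upper
                      ; edge       = λ {E} {F} E∼F → extremal-signs E∼F (lower E) (upper F)
                      } , λ F → rowSum≈μ (rowSum≤μ F) (upper F))
          where
          rowSum≤μ : ∀ F → rowSum F ≤ μ
          rowSum≤μ F = ≤-trans (rowSum≤c F) (≤-reflexive (≈-sym μ≈c))

        equality⇐ : Fin p → Potential _∼_ s → (∀ F → T F ≈ c) → IsEigenvalue 𝓛 c
        equality⇐ E ρ T≈c found =
          let open Potential ρ
              F , E∼F = coface E
              open Aligned lower upper lower-sign upper-sign edge (λ F → ≈-trans (rowSum≈T F) (T≈c F))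
          in found (v , v≉0 E∼F , λ E → ≈-trans (apply v E) (v-eigen E))

        equality⇔ : ((∀ F G → T F ≈ T G) → ∀ F → T F ≈ c) →
          ∀ {Balanced : Set} → (¬ ¬ Balanced → Balanced) → (Potential _∼_ s → Balanced) →
          (Fin p → Balanced → Potential _∼_ s) → Fin q →
          ∀ {μ} → IsEigenvalue 𝓛 μ → (∀ ν → IsEigenvalue 𝓛 ν → ν ≤ μ) →
          μ ≈ c ⇔ (Balanced × (∀ F G → T F ≈ T G))
        equality⇔ constant stable toBalanced fromBalanced F₀ {μ} isEigenvalue largest = mk⇔
          (λ μ≈c →
            stable (λ ¬goal → equality⇒ isEigenvalue μ≈c λ (ρ , _) → ¬goal (toBalanced ρ)) ,
            (λ F G → ≈-stable λ ¬goal → equality⇒ isEigenvalue μ≈c λ (_ , rowSum≈μ) → ¬goal (begin-equality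
              T F        ≈⟨ rowSum≈T F ⟨
              rowSum F   ≈⟨ rowSum≈μ F ⟩
              μ          ≈⟨ rowSum≈μ G ⟨
              rowSum G   ≈⟨ rowSum≈T G ⟩
              T G        ∎)))
          λ (balanced , T≈T) → ≤-antisym (largest-≤ F₀ isEigenvalue) λ μ<c →
            -- The eigenvector for `μ` only supplies a vertex `E`, as the root of a potential. The
            -- potential makes `c` an eigenvalue, and maximality of `μ` excludes `μ < c`.
            isEigenvalue λ (_ , v≉0 , _) → let E = counterexample v≉0 in
              largest c (equality⇐ E (fromBalanced E balanced) (constant T≈T)) μ<c

-- In place of Defs.sum, which is an alias and would be compared with its own
-- unfolding, ∑ +-0-rawMonoid is used below.
open import Defs hiding (sum)

-- The real numbers

module Real where
  open ℚ.+-*-Solver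
  open ℚ.≤-Reasoning

  eventually₂ : ∀ {P Q : ℕ → Set} → ∃[ M ] (∀ n → M ℕ.≤ n → P n) → ∃[ N ] (∀ n → N ℕ.≤ n → Q n) →
                ∃[ N ] (∀ n → N ℕ.≤ n → P n × Q n)
  eventually₂ (M , f) (N , g) = M ℕ.⊔ N , λ n le → f n (ℕ.m⊔n≤o⇒m≤o M N le) , g n (ℕ.m⊔n≤o⇒n≤o M N le)

  eventually-map : ∀ {P Q : ℕ → Set} → (∀ n → P n → Q n) →
                   ∃[ M ] (∀ n → M ℕ.≤ n → P n) → ∃[ N ] (∀ n → N ℕ.≤ n → Q n)
  eventually-map h (M , f) = M , λ n le → h n (f n le)

  pointwise : ∀ {x y} → (∀ n → seq x n ≡ seq y n) → x ≈ y
  pointwise {x} {y} eq ε = 0 , λ n _ →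
    subst (ℚ._< ε) (≡.sym (cong ℚ.∣_∣ (≡.trans (cong (ℚ._- seq y n) (eq n)) (ℚ.+-inverseʳ (seq y n)))))
      (Rational.0<pos ε)

  ≈-refl : ∀ {x} → x ≈ x
  ≈-refl {x} = pointwise {x} {x} λ _ → refl

  ≈-sym : ∀ {x y} → x ≈ y → y ≈ x
  ≈-sym {x} {y} x≈y ε = eventually-map (λ n → subst (ℚ._< ε) (Rational.∣-∣-sym (seq x n) (seq y n))) (x≈y ε)

  ≈-trans : ∀ {x y z} → x ≈ y → y ≈ z → x ≈ z
  ≈-trans {x} {y} {z} x≈y y≈z ε =
    eventually-map (λ n (h , h′) → triangle (seq x n) (seq y n) (seq z n) h h′)
      (eventually₂ (x≈y (½ ℚ.* ε) {{Rational.½-pos ε}}) (y≈z (½ ℚ.* ε) {{Rational.½-pos ε}}))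
    where
    triangle : ∀ p q r → ℚ.∣ p ℚ.- q ∣ ℚ.< ½ ℚ.* ε → ℚ.∣ q ℚ.- r ∣ ℚ.< ½ ℚ.* ε → ℚ.∣ p ℚ.- r ∣ ℚ.< ε
    triangle p q r h h′ = subst (ℚ._< ε)
      (cong ℚ.∣_∣ (solve 3 (λ p q r → (p :+ q) :- (q :+ r) := p :- r) refl p q r))
      (Rational.+-dist p q q r h h′)

  +-cong : ∀ {x x′ y y′} → x ≈ x′ → y ≈ y′ → x + y ≈ x′ + y′
  +-cong {x} {x′} {y} {y′} x≈ y≈ ε =
    eventually-map (λ n (h , h′) → Rational.+-dist (seq x n) (seq y n) (seq x′ n) (seq y′ n) h h′)
      (eventually₂ (x≈ (½ ℚ.* ε) {{Rational.½-pos ε}}) (y≈ (½ ℚ.* ε) {{Rational.½-pos ε}}))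

  *-cong : ∀ {x x′ y y′} → x ≈ x′ → y ≈ y′ → x * y ≈ x′ * y′
  *-cong {x} {x′} {y} {y′} x≈ y≈ ε {{ε>0}} =
    let B , B>0 , evB = Rational.bounded x
        C , C>0 , evC = Rational.bounded y′
        β , β>0 , eB = Rational.tolerance ε B {{ε>0}} {{B>0}}
        γ , γ>0 , eC = Rational.tolerance ε C {{ε>0}} {{C>0}}
    in eventually-map
         (λ n ((hB , hC) , hx , hy) → Rational.*-dist (seq x n) (seq y n) (seq x′ n) (seq y′ n)
            B C β γ ε {{B>0}} {{C>0}} eB eC hB hC hx hy)
         (eventually₂ (eventually₂ evB evC) (eventually₂ (x≈ γ {{γ>0}}) (y≈ β {{β>0}})))

  -- As a product with `-1`, negation inherits its Cauchy property and its congruence from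
  -- multiplication.
  -_ : ℝ → ℝ
  - x = fromℤ -1ℤ * x

  isEquivalence : IsEquivalence _≈_
  isEquivalence = record
    { refl  = λ {x} → ≈-refl {x}
    ; sym   = λ {x} {y} → ≈-sym {x} {y}
    ; trans = λ {x} {y} {z} → ≈-trans {x} {y} {z}
    }

  setoid : Setoid 0ℓ 0ℓ
  setoid = record { isEquivalence = isEquivalence }

  isCommutativeRing : IsCommutativeRing _≈_ _+_ _*_ -_ 0ℝ 1ℝ
  isCommutativeRing = record
    { isRing = record
      { +-isAbelianGroup = record
        { isGroup = record
          { isMonoid = record
            { isSemigroup = record
              { isMagma = record
                { isEquivalence = isEquivalence
                ; ∙-cong = λ {x} {x′} {y} {y′} → +-cong {x} {x′} {y} {y′}
                }
              ; assoc = λ x y z → pointwise {(x + y) + z} {x + (y + z)} λ n →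
                  ℚ.+-assoc (seq x n) (seq y n) (seq z n)
              }
            ; identity = (λ x → pointwise {0ℝ + x} {x} λ n → ℚ.+-identityˡ (seq x n))
                       , (λ x → pointwise {x + 0ℝ} {x} λ n → ℚ.+-identityʳ (seq x n))
            }
          ; inverse = (λ x → pointwise {(- x) + x} {0ℝ} λ n →
                          solve 1 (λ a → con (ℚ.- 1ℚ) :* a :+ a := con 0ℚ) refl (seq x n))
                    , (λ x → pointwise {x + - x} {0ℝ} λ n →
                          solve 1 (λ a → a :+ con (ℚ.- 1ℚ) :* a := con 0ℚ) refl (seq x n))
          ; ⁻¹-cong = λ {x} {y} → *-cong {fromℤ -1ℤ} {fromℤ -1ℤ} {x} {y} (≈-refl {fromℤ -1ℤ})
          }
        ; comm = λ x y → pointwise {x + y} {y + x} λ n → ℚ.+-comm (seq x n) (seq y n)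
        }
      ; *-cong = λ {x} {x′} {y} {y′} → *-cong {x} {x′} {y} {y′}
      ; *-assoc = λ x y z → pointwise {(x * y) * z} {x * (y * z)} λ n →
          ℚ.*-assoc (seq x n) (seq y n) (seq z n)
      ; *-identity = (λ x → pointwise {1ℝ * x} {x} λ n → ℚ.*-identityˡ (seq x n))
                   , (λ x → pointwise {x * 1ℝ} {x} λ n → ℚ.*-identityʳ (seq x n))
      ; distrib = (λ x y z → pointwise {x * (y + z)} {x * y + x * z} λ n →
                      ℚ.*-distribˡ-+ (seq x n) (seq y n) (seq z n))
                , (λ x y z → pointwise {(y + z) * x} {y * x + z * x} λ n →
                      ℚ.*-distribʳ-+ (seq x n) (seq y n) (seq z n))
      }
    ; *-comm = λ x y → pointwise {x * y} {y * x} λ n → ℚ.*-comm (seq x n) (seq y n)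
    }

  <-irrefl : ∀ {x} → ¬ x < x
  <-irrefl {x} (δ , δ>0 , N , h) = ℚ.<-irrefl refl (ℚ.<-≤-trans
    (begin-strict
      seq x N          ≡⟨ ℚ.+-identityʳ (seq x N) ⟨
      seq x N ℚ.+ 0ℚ   <⟨ ℚ.+-monoʳ-< (seq x N) (Rational.0<pos δ {{δ>0}}) ⟩
      seq x N ℚ.+ δ    ∎) (h N ℕ.≤-refl))

  <-respˡ-≈ : ∀ {x y z} → x ≈ y → x < z → y < z
  <-respˡ-≈ {x} {y} {z} x≈y (δ , δ>0 , ev) = ½ ℚ.* δ , Rational.½-pos δ {{δ>0}} ,
    eventually-map (λ n (h , h′) → let p = seq x n ; q = seq y n in begin
        q ℚ.+ ½ ℚ.* δ
          ≤⟨ ℚ.+-monoˡ-≤ (½ ℚ.* δ) (ℚ.<⇒≤ (Rational.dist⇒< q p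
               (subst (ℚ._< ½ ℚ.* δ) (Rational.∣-∣-sym p q) h))) ⟩
        p ℚ.+ ½ ℚ.* δ ℚ.+ ½ ℚ.* δ
          ≡⟨ solve 2 (λ p δ → p :+ con ½ :* δ :+ con ½ :* δ := p :+ δ) refl p δ ⟩
        p ℚ.+ δ
          ≤⟨ h′ ⟩
        seq z n ∎)
      (eventually₂ (x≈y (½ ℚ.* δ) {{Rational.½-pos δ {{δ>0}}}}) ev)

  <-respʳ-≈ : ∀ {x y z} → x ≈ y → z < x → z < y
  <-respʳ-≈ {x} {y} {z} x≈y (δ , δ>0 , ev) = ½ ℚ.* δ , Rational.½-pos δ {{δ>0}} ,
    eventually-map (λ n (h , h′) → let p = seq x n ; q = seq y n ; r = seq z n in begin
        r ℚ.+ ½ ℚ.* δ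
          ≡⟨ solve 2 (λ r δ → r :+ con ½ :* δ := r :+ δ :- con ½ :* δ) refl r δ ⟩
        r ℚ.+ δ ℚ.- ½ ℚ.* δ
          ≤⟨ ℚ.+-monoˡ-≤ (ℚ.- (½ ℚ.* δ)) (ℚ.≤-trans h′ (ℚ.<⇒≤ (Rational.dist⇒< p q h))) ⟩
        q ℚ.+ ½ ℚ.* δ ℚ.- ½ ℚ.* δ
          ≡⟨ solve 2 (λ q δ → q :+ δ :- δ := q) refl q (½ ℚ.* δ) ⟩
        q ∎)
      (eventually₂ (x≈y (½ ℚ.* δ) {{Rational.½-pos δ {{δ>0}}}}) ev)

  <-trans : ∀ {x y z} → x < y → y < z → x < z
  <-trans {x} {y} {z} (δ , δ>0 , ev) (η , η>0 , ev′) = δ , δ>0 , eventually-map (λ n (h , h′) → begin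
    seq x n ℚ.+ δ    ≤⟨ h ⟩
    seq y n          ≡⟨ ℚ.+-identityʳ (seq y n) ⟨
    seq y n ℚ.+ 0ℚ   ≤⟨ ℚ.+-monoʳ-≤ (seq y n) (ℚ.<⇒≤ (Rational.0<pos η {{η>0}})) ⟩
    seq y n ℚ.+ η    ≤⟨ h′ ⟩
    seq z n          ∎) (eventually₂ ev ev′)

  _-_ : ℝ → ℝ → ℝ
  x - y = x + - y

  seq-- : ∀ x y n → seq (x - y) n ≡ seq x n ℚ.- seq y n
  seq-- x y n = solve 2 (λ a b → a :+ con (ℚ.- 1ℚ) :* b := a :- b) refl (seq x n) (seq y n)

  0<y-x⇒x<y : ∀ {x y} → 0ℝ < y - x → x < y
  0<y-x⇒x<y {x} {y} (δ , δ>0 , ev) = δ , δ>0 , eventually-map (λ n h → begin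
      seq x n ℚ.+ δ                        ≡⟨ solve 2 (λ a d → a :+ d := a :+ (con 0ℚ :+ d)) refl (seq x n) δ ⟩
      seq x n ℚ.+ (0ℚ ℚ.+ δ)               ≤⟨ ℚ.+-monoʳ-≤ (seq x n) h ⟩
      seq x n ℚ.+ seq (y - x) n            ≡⟨ cong (seq x n ℚ.+_) (seq-- y x n) ⟩
      seq x n ℚ.+ (seq y n ℚ.- seq x n)    ≡⟨ solve 2 (λ a b → a :+ (b :- a) := b) refl (seq x n) (seq y n) ⟩
      seq y n                              ∎) ev

  -- A Cauchy sequence is located with respect to the rationals 0 and ε.
  small-or-positive : ∀ a ε .{{_ : Positive ε}} → ∃[ N ] (∀ n → N ℕ.≤ n → seq a n ℚ.< ε) ⊎ 0ℝ < a
  small-or-positive a ε with cauchy a (½ ℚ.* (½ ℚ.* ε)) {{Rational.½-pos (½ ℚ.* ε) {{Rational.½-pos ε}}}}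
  -- The threshold is three quarters of `ε` and later terms stay within a quarter of `seq a N`:
  -- below it they remain under `ε`, otherwise they remain at least half of `ε`.
  ... | N , h with seq a N ℚ.<? ½ ℚ.* ε ℚ.+ ½ ℚ.* (½ ℚ.* ε)
  ...   | yes lt = inj₁ (N , λ n N≤n → begin-strict
          seq a n                                    <⟨ Rational.dist⇒< (seq a n) (seq a N) (h n N N≤n ℕ.≤-refl) ⟩
          seq a N ℚ.+ κ                              <⟨ ℚ.+-monoˡ-< κ lt ⟩
          ½ ℚ.* ε ℚ.+ κ ℚ.+ κ                        ≡⟨ solve 1 (λ e → con ½ :* e :+ con ½ :* (con ½ :* e)
                                                           :+ con ½ :* (con ½ :* e) := e) refl ε ⟩
          ε                                          ∎)
    where κ = ½ ℚ.* (½ ℚ.* ε)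
  ...   | no ≮ = inj₂ (½ ℚ.* ε , Rational.½-pos ε , N , λ n N≤n → begin
          0ℚ ℚ.+ ½ ℚ.* ε              ≡⟨ solve 2 (λ h k → con 0ℚ :+ h := h :+ k :- k) refl (½ ℚ.* ε) κ ⟩
          ½ ℚ.* ε ℚ.+ κ ℚ.- κ         ≤⟨ ℚ.+-monoˡ-≤ (ℚ.- κ) (ℚ.≤-trans (ℚ.≮⇒≥ ≮)
                                           (ℚ.<⇒≤ (Rational.dist⇒< (seq a N) (seq a n) (h N n ℕ.≤-refl N≤n)))) ⟩
          seq a n ℚ.+ κ ℚ.- κ         ≡⟨ solve 2 (λ q k → q :+ k :- k := q) refl (seq a n) κ ⟩
          seq a n                     ∎)
    where κ = ½ ℚ.* (½ ℚ.* ε)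

  close-or-less : ∀ x y ε .{{_ : Positive ε}} → ∃[ N ] (∀ n → N ℕ.≤ n → seq x n ℚ.< seq y n ℚ.+ ε) ⊎ y < x
  close-or-less x y ε = Sum.map
    (eventually-map λ n h → begin-strict
      seq x n                               ≡⟨ solve 2 (λ a b → a := b :+ (a :- b)) refl (seq x n) (seq y n) ⟩
      seq y n ℚ.+ (seq x n ℚ.- seq y n)     ≡⟨ cong (seq y n ℚ.+_) (seq-- x y n) ⟨
      seq y n ℚ.+ seq (x - y) n             <⟨ ℚ.+-monoʳ-< (seq y n) h ⟩
      seq y n ℚ.+ ε                         ∎)
    (0<y-x⇒x<y {y} {x})
    (small-or-positive (x - y) ε)

  -- Let `δ` be the gap from `x` to `y`. If `y` eventually exceeds `z` by less than half of `δ`, the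
  -- other half still separates `x` from `z`; otherwise `z < y`.
  <-cotrans : ∀ {x y} z → x < y → x < z ⊎ z < y
  <-cotrans {x} {y} z (δ , δ>0 , ev) = Sum.map₁
    (λ ev′ → ½ ℚ.* δ , Rational.½-pos δ {{δ>0}} , eventually-map (λ n (h , h′) →
      let p = seq x n ; q = seq y n ; r = seq z n in begin
        p ℚ.+ ½ ℚ.* δ                 ≡⟨ solve 2 (λ r δ → r :+ con ½ :* δ := r :+ δ :- con ½ :* δ) refl p δ ⟩
        p ℚ.+ δ ℚ.- ½ ℚ.* δ           ≤⟨ ℚ.+-monoˡ-≤ (ℚ.- (½ ℚ.* δ)) (ℚ.≤-trans h (ℚ.<⇒≤ h′)) ⟩
        r ℚ.+ ½ ℚ.* δ ℚ.- ½ ℚ.* δ     ≡⟨ solve 2 (λ q k → q :+ k :- k := q) refl r (½ ℚ.* δ) ⟩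
        r                             ∎) (eventually₂ ev ev′))
    (close-or-less y z (½ ℚ.* δ) {{Rational.½-pos δ {{δ>0}}}})

  -- For each `ε` the located comparison is made in both directions. The hypotheses rule out its
  -- strict outcomes, and the two remaining one-sided bounds give closeness.
  <-tight : ∀ {x y} → ¬ x < y → ¬ y < x → x ≈ y
  <-tight {x} {y} x≮y y≮x ε = close (close-or-less x y ε) (close-or-less y x ε)
    where
    close : ∃[ N ] (∀ n → N ℕ.≤ n → seq x n ℚ.< seq y n ℚ.+ ε) ⊎ y < x →
            ∃[ N ] (∀ n → N ℕ.≤ n → seq y n ℚ.< seq x n ℚ.+ ε) ⊎ x < y →
            ∃[ N ] (∀ n → N ℕ.≤ n → ℚ.∣ seq x n ℚ.- seq y n ∣ ℚ.< ε)
    close (inj₂ y<x) _          = contradiction y<x y≮x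
    close _          (inj₂ x<y) = contradiction x<y x≮y
    close (inj₁ (M , f)) (inj₁ (N , g)) = M ℕ.⊔ N , λ n le →
      Rational.<⇒dist (seq x n) (seq y n) (f n (ℕ.m⊔n≤o⇒m≤o M N le)) (g n (ℕ.m⊔n≤o⇒n≤o M N le))

  +-monoˡ-< : ∀ z {x y} → x < y → x + z < y + z
  +-monoˡ-< z {x} {y} (δ , δ>0 , ev) = δ , δ>0 , eventually-map (λ n h → begin
    seq x n ℚ.+ seq z n ℚ.+ δ   ≡⟨ solve 3 (λ a b d → a :+ b :+ d := a :+ d :+ b) refl (seq x n) (seq z n) δ ⟩
    seq x n ℚ.+ δ ℚ.+ seq z n   ≤⟨ ℚ.+-monoˡ-≤ (seq z n) h ⟩
    seq y n ℚ.+ seq z n         ∎) ev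

  *-monoˡ-< : ∀ {z} → 0ℝ < z → ∀ {x y} → x < y → z * x < z * y
  *-monoˡ-< {z} (η , η>0 , ev) {x} {y} (δ , δ>0 , ev′) = η ℚ.* δ , ℚ.pos*pos⇒pos η {{η>0}} δ {{δ>0}} ,
    eventually-map (λ n (h , h′) → let η≤z = subst (ℚ._≤ seq z n) (ℚ.+-identityˡ η) h in begin
      seq z n ℚ.* seq x n ℚ.+ η ℚ.* δ
        ≤⟨ ℚ.+-monoʳ-≤ (seq z n ℚ.* seq x n)
             (ℚ.*-monoʳ-≤-nonNeg δ {{ℚ.pos⇒nonNeg δ {{δ>0}}}} η≤z) ⟩
      seq z n ℚ.* seq x n ℚ.+ seq z n ℚ.* δ
        ≡⟨ ℚ.*-distribˡ-+ (seq z n) (seq x n) δ ⟨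
      seq z n ℚ.* (seq x n ℚ.+ δ)
        ≤⟨ ℚ.*-monoˡ-≤-nonNeg (seq z n)
             {{ℚ.nonNegative (ℚ.≤-trans (ℚ.<⇒≤ (Rational.0<pos η {{η>0}})) η≤z)}} h′ ⟩
      seq z n ℚ.* seq y n ∎) (eventually₂ ev ev′)

  -- An eventual bound `B` on the absolute value of `x` keeps the reciprocal at least `1/ B` away
  -- from zero.
  recip-positive : ∀ x → 0ℝ < recip x
  recip-positive (x , δ , δ>0 , ev) =
    let B , B>0 , evB = Rational.bounded x
        nz = ℚ.pos⇒nonZero B {{B>0}}
        i = (1/ B) {{nz}}
        i>0 = ℚ.1/pos⇒pos B {{B>0}}
    in i , i>0 , eventually-map (λ n (h , hB) →
        let a   = seq x n
            0<a = ℚ.<-≤-trans (Rational.0<pos δ {{δ>0}}) (subst (ℚ._≤ a) (ℚ.+-identityˡ δ) h)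
            a*r = Reciprocal.recipℚ-inverse a 0<a
            0<r = ℚ.*-cancelˡ-<-nonNeg a {{ℚ.nonNegative (ℚ.<⇒≤ 0<a)}}
                    (subst₂ ℚ._<_ (≡.sym (ℚ.*-zeroʳ a)) (≡.sym a*r) (ℚ.positive⁻¹ 1ℚ))
        in begin
          0ℚ ℚ.+ i                      ≡⟨ ℚ.+-identityˡ i ⟩
          i                             ≡⟨ ℚ.*-identityʳ i ⟨
          i ℚ.* 1ℚ                      ≡⟨ cong (i ℚ.*_) a*r ⟨
          i ℚ.* (a ℚ.* recipℚ a)        ≤⟨ ℚ.*-monoˡ-≤-nonNeg i {{ℚ.pos⇒nonNeg i {{i>0}}}}
                                             (ℚ.*-monoʳ-≤-nonNeg (recipℚ a) {{ℚ.nonNegative (ℚ.<⇒≤ 0<r)}}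
                                               (ℚ.<⇒≤ (ℚ.≤-<-trans (Rational.≤∣∣ a) hB))) ⟩
          i ℚ.* (B ℚ.* recipℚ a)        ≡⟨ ℚ.*-assoc i B (recipℚ a) ⟨
          i ℚ.* B ℚ.* recipℚ a          ≡⟨ cong (ℚ._* recipℚ a) (ℚ.*-inverseˡ B {{nz}}) ⟩
          1ℚ ℚ.* recipℚ a               ≡⟨ ℚ.*-identityˡ (recipℚ a) ⟩
          recipℚ a                      ∎) (eventually₂ ev evB)


  pointwise-≤ : ∀ {x y} → (∀ n → seq x n ℚ.≤ seq y n) → x ≤ y
  pointwise-≤ {x} {y} x≤y (δ , δ>0 , N , h) = ℚ.<-irrefl refl (begin-strict
    seq y N          ≡⟨ ℚ.+-identityʳ (seq y N) ⟨
    seq y N ℚ.+ 0ℚ   <⟨ ℚ.+-monoʳ-< (seq y N) (Rational.0<pos δ {{δ>0}}) ⟩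
    seq y N ℚ.+ δ    ≤⟨ h N ℕ.≤-refl ⟩
    seq x N          ≤⟨ x≤y N ⟩
    seq y N          ∎)

  seq-≤-max : ∀ {m} .{{_ : NonZero m}} (f : Fin m → ℝ) k n → seq (f k) n ℚ.≤ seq (max f) n
  seq-≤-max {suc ℕ.zero}  f zero    n = ℚ.≤-refl
  seq-≤-max {suc (suc m)} f zero    n = ℚ.p≤p⊔q (seq (f zero) n) (seq (max (f ∘ suc)) n)
  seq-≤-max {suc (suc m)} f (suc k) n = ℚ.≤-trans (seq-≤-max (f ∘ suc) k n)
    (ℚ.p≤q⊔p (seq (f zero) n) (seq (max (f ∘ suc)) n))

  ≤-max : ∀ {m} .{{_ : NonZero m}} (f : Fin m → ℝ) k → f k ≤ max f
  ≤-max f k = pointwise-≤ {f k} {max f} (seq-≤-max f k)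

  ⊔-cong : ∀ {x x′ y y′} → x ≈ x′ → y ≈ y′ → x ⊔ y ≈ x′ ⊔ y′
  ⊔-cong {x} {x′} {y} {y′} x≈ y≈ ε =
    eventually-map (λ n (h , h′) → Rational.⊔-dist (seq x n) (seq y n) (seq x′ n) (seq y′ n) h h′)
      (eventually₂ (x≈ ε) (y≈ ε))

  max-cong : ∀ {m} .{{_ : NonZero m}} {f g : Fin m → ℝ} → (∀ k → f k ≈ g k) → max f ≈ max g
  max-cong {suc ℕ.zero}              f≈g = f≈g zero
  max-cong {suc (suc m)} {{nz}} {f} {g} f≈g =
    ⊔-cong {f zero} {g zero} {max (f ∘ suc)} {max (g ∘ suc)} (f≈g zero) (max-cong (f≈g ∘ suc))

  max-const : ∀ {m} .{{_ : NonZero m}} x → max {m} (λ _ → x) ≈ x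
  max-const {suc ℕ.zero}  x = ≈-refl {x}
  max-const {suc (suc m)} x = ≈-trans {x ⊔ max {suc m} (λ _ → x)} {x ⊔ x} {x}
    (⊔-cong {x} {x} {max {suc m} (λ _ → x)} {x} (≈-refl {x}) (max-const {suc m} x))
    (pointwise {x ⊔ x} {x} λ n → ℚ.⊔-idem (seq x n))

realIsOrderedRing : IsOrderedRing _≈_ _<_ _+_ _*_ Real.-_ 0ℝ 1ℝ (∑ +-0-rawMonoid) fromℤ
realIsOrderedRing = record
  { isCommutativeRing = Real.isCommutativeRing
  ; <-irrefl  = λ {x} → Real.<-irrefl {x}
  ; <-respˡ-≈ = λ {x} {y} {z} → Real.<-respˡ-≈ {x} {y} {z}
  ; <-respʳ-≈ = λ {x} {y} {z} → Real.<-respʳ-≈ {x} {y} {z}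
  ; <-trans   = λ {x} {y} {z} → Real.<-trans {x} {y} {z}
  ; <-cotrans = λ {x} {y} → Real.<-cotrans {x} {y}
  ; <-tight   = λ {x} {y} → Real.<-tight {x} {y}
  ; +-monoˡ-< = λ z {x} {y} → Real.+-monoˡ-< z {x} {y}
  ; *-monoˡ-< = λ {z} 0<z {x} {y} → Real.*-monoˡ-< {z} 0<z {x} {y}
  ; sum-[]    = λ f → Real.≈-refl {∑ +-0-rawMonoid f}
  ; sum-∷     = λ f → Real.≈-refl {∑ +-0-rawMonoid f}
  ; ⟦0⟧       = Real.pointwise {fromℤ 0ℤ} {0ℝ} λ _ → refl
  ; ⟦1⟧       = Real.pointwise {fromℤ 1ℤ} {1ℝ} λ _ → refl
  ; ⟦-1⟧      = Real.pointwise {fromℤ -1ℤ} {Real.- 1ℝ} λ _ → refl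
  }

module RealOrder = OrderedRingProperties
  (orderedRing ℝ _≈_ _<_ _+_ _*_ Real.-_ 0ℝ 1ℝ (∑ +-0-rawMonoid) fromℤ realIsOrderedRing)

-- Conversion checking of x * y or x + y on real numbers descends into their
-- Cauchy proofs unless the two sides agree syntactically.  Sums over a variable
-- index set do not reduce, so definitions are unfolded at sums only, by
-- propositional equalities that are then transported through the operations.
module RealMatrix where
  open Relation.Binary.Reasoning.Setoid Real.setoid public

  *-congˡ : ∀ x {y z} → y ≈ z → x * y ≈ x * z
  *-congˡ x {y} {z} = Real.*-cong {x} {x} {y} {z} (Real.≈-refl {x})

  *-congˡ-≡ : ∀ x {y z} → y ≡ z → x * y ≈ x * z
  *-congˡ-≡ x {y} refl = Real.≈-refl {x * y}

  *-congʳ-≡ : ∀ x {y z} → y ≡ z → y * x ≈ z * x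
  *-congʳ-≡ x {y} refl = Real.≈-refl {y * x}

  ·-unfold : ∀ {m n} (A : Matrix m n) v i → (A · v) i ≡ ∑ +-0-rawMonoid λ j → A i j * v j
  ·-unfold A v i = refl

  ⊗-unfold : ∀ {l m n} (A : Matrix l m) (B : Matrix m n) i k → (A ⊗ B) i k ≡ ∑ +-0-rawMonoid λ j → A i j * B j k
  ⊗-unfold A B i k = refl

  diag-unfold : ∀ {n} (d : Fin n → ℝ) i j → diag d i j ≡ RealOrder.diagonal d i j
  diag-unfold d i j = refl

  ⊗-apply : ∀ {l m n} (A : Matrix l m) (B : Matrix m n) v i → ((A ⊗ B) · v) i ≈ (A · (B · v)) i
  ⊗-apply A B v i = begin
    ∑ +-0-rawMonoid (λ k → (A ⊗ B) i k * v k)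
      ≈⟨ RealOrder.sum-cong {f = λ k → (A ⊗ B) i k * v k} {λ k → ∑ +-0-rawMonoid (λ j → A i j * B j k) * v k}
           (λ k → *-congʳ-≡ (v k) (⊗-unfold A B i k)) ⟩
    ∑ +-0-rawMonoid (λ k → ∑ +-0-rawMonoid (λ j → A i j * B j k) * v k)
      ≈⟨ RealOrder.sum-assoc (A i) B v ⟩
    ∑ +-0-rawMonoid (λ j → A i j * ∑ +-0-rawMonoid λ k → B j k * v k)
      ≈⟨ RealOrder.sum-cong {f = λ j → A i j * ∑ +-0-rawMonoid λ k → B j k * v k} {λ j → A i j * (B · v) j}
           (λ j → *-congˡ-≡ (A i j) (≡.sym (·-unfold B v j))) ⟩
    ∑ +-0-rawMonoid (λ j → A i j * (B · v) j) ∎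

  ·-congˡ : ∀ {m n} (A : Matrix m n) {v v′} → (∀ k → v k ≈ v′ k) → ∀ i → (A · v) i ≈ (A · v′) i
  ·-congˡ A {v} {v′} v≈v′ i = RealOrder.sum-cong {f = λ k → A i k * v k} {λ k → A i k * v′ k}
    λ k → *-congˡ (A i k) {v k} {v′ k} (v≈v′ k)

  diag-apply : ∀ {n} (d v : Fin n → ℝ) i → (diag d · v) i ≈ d i * v i
  diag-apply d v i = begin
    ∑ +-0-rawMonoid (λ j → diag d i j * v j)
      ≈⟨ RealOrder.sum-cong {f = λ j → diag d i j * v j} {λ j → RealOrder.diagonal d i j * v j}
           (λ j → *-congʳ-≡ (v j) (diag-unfold d i j)) ⟩
    ∑ +-0-rawMonoid (λ j → RealOrder.diagonal d i j * v j)
      ≈⟨ RealOrder.sum-diag i d v ⟩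
    d i * v i ∎

  sandwich-apply : ∀ {m n} (d : Fin m → ℝ) (A : Matrix n m) (d′ : Fin n → ℝ) v i →
    ((diag d ⊗ A ᵀ ⊗ diag d′ ⊗ A) · v) i ≈ d i * (A ᵀ · λ k → d′ k * (A · v) k) i
  sandwich-apply d A d′ v i = begin
    ((diag d ⊗ A ᵀ ⊗ diag d′ ⊗ A) · v) i           ≈⟨ ⊗-apply (diag d ⊗ A ᵀ ⊗ diag d′) A v i ⟩
    ((diag d ⊗ A ᵀ ⊗ diag d′) · (A · v)) i         ≈⟨ ⊗-apply (diag d ⊗ A ᵀ) (diag d′) (A · v) i ⟩
    ((diag d ⊗ A ᵀ) · (diag d′ · (A · v))) i       ≈⟨ ⊗-apply (diag d) (A ᵀ) (diag d′ · (A · v)) i ⟩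
    (diag d · (A ᵀ · (diag d′ · (A · v)))) i       ≈⟨ diag-apply d (A ᵀ · (diag d′ · (A · v))) i ⟩
    d i * (A ᵀ · (diag d′ · (A · v))) i
      ≈⟨ *-congˡ (d i) {(A ᵀ · (diag d′ · (A · v))) i} {(A ᵀ · λ k → d′ k * (A · v) k) i}
           (·-congˡ (A ᵀ) {diag d′ · (A · v)} {λ k → d′ k * (A · v) k} (diag-apply d′ (A · v)) i) ⟩
    d i * (A ᵀ · λ k → d′ k * (A · v) k) i ∎

-- The bound and its equality case for real matrices

fin-nonZero : ∀ {n} .{{_ : NonZero n}} → Fin n
fin-nonZero {suc n} = zero

-- Determines x from the type of a proof of P x without unfolding P.
data Packed {A : Set} (P : A → Set) (x : A) : Set where
  pack : P x → Packed P x

module RealLaplacian {p q : ℕ} .{{_ : NonZero q}} {_∼_ : Fin p → Fin q → Set} (_∼?_ : ∀ E F → Dec (E ∼ F))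
  (s : Fin p → Fin q → ℤ)
  (s-sign : ∀ E F → E ∼ F → IsSign (s E F)) (s-zero : ∀ E F → ¬ E ∼ F → s E F ≡ 0ℤ)
  (r : Fin p → ℝ) (0<r : ∀ E → 0ℝ < r E) (w : Fin q → ℝ) (0<w : ∀ F → 0ℝ < w F) where

  open RealMatrix

  module _ {M : Matrix q p} (M≡ : ∀ F E → M F E ≡ fromℤ (s E F)) where

    D-apply : ∀ v F → (M · v) F ≈ ∑ +-0-rawMonoid λ E → fromℤ (s E F) * v E
    D-apply v F = begin
      ∑ +-0-rawMonoid (λ E → M F E * v E)
        ≈⟨ RealOrder.sum-cong {f = λ E → M F E * v E} {λ E → fromℤ (s E F) * v E} (λ E → *-congʳ-≡ (v E) (M≡ F E)) ⟩
      ∑ +-0-rawMonoid (λ E → fromℤ (s E F) * v E) ∎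

    ᵀ-entry : ∀ E F → (M ᵀ) E F ≡ fromℤ (s E F)
    ᵀ-entry E F = M≡ F E

    Dᵀ-apply : ∀ u E → (M ᵀ · u) E ≈ ∑ +-0-rawMonoid λ F → fromℤ (s E F) * u F
    Dᵀ-apply u E = begin
      ∑ +-0-rawMonoid (λ F → (M ᵀ) E F * u F)
        ≈⟨ RealOrder.sum-cong {f = λ F → (M ᵀ) E F * u F} {λ F → fromℤ (s E F) * u F}
             (λ F → *-congʳ-≡ (u F) (ᵀ-entry E F)) ⟩
      ∑ +-0-rawMonoid (λ F → fromℤ (s E F) * u F) ∎

    -- The variable `x` stands for `M · v`, so the inner sum stays opaque while the outer factors
    -- are rewritten.
    product-apply-through : ∀ v {x : Fin q → ℝ} → (∀ F → (M · v) F ≈ x F) → ∀ E →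
      ((diag r ⊗ M ᵀ ⊗ diag w ⊗ M) · v) E ≈ r E * ∑ +-0-rawMonoid λ F → fromℤ (s E F) * (w F * x F)
    product-apply-through v {x} Mv≈x E = begin
      ((diag r ⊗ M ᵀ ⊗ diag w ⊗ M) · v) E
        ≈⟨ sandwich-apply r M w v E ⟩
      r E * (M ᵀ · λ F → w F * (M · v) F) E
        ≈⟨ *-congˡ (r E) {(M ᵀ · λ F → w F * (M · v) F) E} {(M ᵀ · λ F → w F * x F) E}
             (·-congˡ (M ᵀ) {λ F → w F * (M · v) F} {λ F → w F * x F}
               (λ F → *-congˡ (w F) {(M · v) F} {x F} (Mv≈x F)) E) ⟩
      r E * (M ᵀ · λ F → w F * x F) E
        ≈⟨ *-congˡ (r E) {(M ᵀ · λ F → w F * x F) E} {∑ +-0-rawMonoid λ F → fromℤ (s E F) * (w F * x F)}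
             (Dᵀ-apply (λ F → w F * x F) E) ⟩
      r E * ∑ +-0-rawMonoid (λ F → fromℤ (s E F) * (w F * x F)) ∎

    product-apply : ∀ v E → ((diag r ⊗ M ᵀ ⊗ diag w ⊗ M) · v) E ≈
      r E * ∑ +-0-rawMonoid λ F → fromℤ (s E F) * (w F * ∑ +-0-rawMonoid λ j → fromℤ (s j F) * v j)
    product-apply v E = product-apply-through v {λ F → ∑ +-0-rawMonoid λ j → fromℤ (s j F) * v j} (D-apply v) E

  IsFactored : Matrix p p → Set
  IsFactored 𝓛 = ∀ (v : Fin p → ℝ) (E : Fin p) → (𝓛 · v) E ≈
    r E * ∑ +-0-rawMonoid λ F → fromℤ (s E F) * (w F * ∑ +-0-rawMonoid λ j → fromℤ (s j F) * v j)

  IsSigned : Matrix q p → Set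
  IsSigned M = ∀ F E → M F E ≡ fromℤ (s E F)

  -- All matrices are variables tied together by equations, so matching on `refl` substitutes for a
  -- variable instead of comparing real expressions.
  factor : ∀ {𝓛 R M N} → R ≡ diag r → N ≡ diag w → Packed IsSigned M →
           𝓛 ≡ R ⊗ M ᵀ ⊗ N ⊗ M → Packed IsFactored 𝓛
  factor {M = M} refl refl (pack M≡) refl = pack (product-apply {M} M≡)

  IsRowSums : (Fin q → ℝ) → Set
  IsRowSums T = ∀ (F : Fin q) → (∑ +-0-rawMonoid λ E → if ⌊ E ∼? F ⌋ then
    (∑ +-0-rawMonoid λ G → if ⌊ E ∼? G ⌋ then w G else 0ℝ) * r E else 0ℝ) ≈ T F

  rowSum-cong : ∀ {d : Fin p → ℝ} {T : Fin q → ℝ} →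
    (∀ E → (∑ +-0-rawMonoid λ G → if ⌊ E ∼? G ⌋ then w G else 0ℝ) * r E ≈ d E) →
    (∀ F → T F ≡ ∑ +-0-rawMonoid λ E → if ⌊ E ∼? F ⌋ then d E else 0ℝ) →
    ∀ F → (∑ +-0-rawMonoid λ E → if ⌊ E ∼? F ⌋ then
             (∑ +-0-rawMonoid λ G → if ⌊ E ∼? G ⌋ then w G else 0ℝ) * r E else 0ℝ) ≈ T F
  rowSum-cong {d} {T} d≈ T≡ F = begin
    ∑ +-0-rawMonoid (λ E → if ⌊ E ∼? F ⌋ then (∑ +-0-rawMonoid λ G → if ⌊ E ∼? G ⌋ then w G else 0ℝ) * r E else 0ℝ)
      ≈⟨ RealOrder.restrict-sum-cong (_∼? F)
           {λ E → (∑ +-0-rawMonoid λ G → if ⌊ E ∼? G ⌋ then w G else 0ℝ) * r E} {d} d≈ ⟩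
    ∑ +-0-rawMonoid (λ E → if ⌊ E ∼? F ⌋ then d E else 0ℝ)
      ≡⟨ T≡ F ⟨
    T F ∎

  weighted-rowSums : ∀ {d : Fin p → ℝ} {T : Fin q → ℝ} →
    (∀ E → d E ≡ ∑ +-0-rawMonoid λ G → if ⌊ E ∼? G ⌋ then w G else 0ℝ) →
    (∀ F → T F ≡ ∑ +-0-rawMonoid λ E → if ⌊ E ∼? F ⌋ then d E * r E else 0ℝ) → Packed IsRowSums T
  weighted-rowSums {d} {T} d≡ T≡ =
    pack (rowSum-cong {λ E → d E * r E} {T} (λ E → *-congʳ-≡ (r E) (≡.sym (d≡ E))) T≡)

  unweighted-rowSums : ∀ {d : Fin p → ℝ} {T : Fin q → ℝ} →
    (∀ E → d E ≡ ∑ +-0-rawMonoid λ G → if ⌊ E ∼? G ⌋ then w G else 0ℝ) → (∀ E → r E ≈ 1ℝ) →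
    (∀ F → T F ≡ ∑ +-0-rawMonoid λ E → if ⌊ E ∼? F ⌋ then d E else 0ℝ) → Packed IsRowSums T
  unweighted-rowSums {d} {T} d≡ r≈1 T≡ = pack (rowSum-cong {d} {T} (λ E → begin
    (∑ +-0-rawMonoid λ G → if ⌊ E ∼? G ⌋ then w G else 0ℝ) * r E   ≈⟨ *-congʳ-≡ (r E) (≡.sym (d≡ E)) ⟩
    d E * r E   ≈⟨ *-congˡ (d E) {r E} {1ℝ} (r≈1 E) ⟩
    d E * 1ℝ    ≈⟨ Real.pointwise {d E * 1ℝ} {d E} (λ n → ℚ.*-identityʳ (seq (d E) n)) ⟩
    d E         ∎) T≡)

  eigenvalue-≤-max : ∀ {𝓛 T} → Packed IsFactored 𝓛 → Packed IsRowSums T → ∀ {μ} → IsEigenvalue 𝓛 μ →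
                     μ ≤ max T
  eigenvalue-≤-max {𝓛} {T} (pack apply) (pack rowSum≈) {μ} =
    RealOrder.Laplacian.Spectrum.largest-≤ _∼?_ s (λ {E} {F} → s-sign E F) (λ {E} {F} → s-zero E F) r 0<r w 0<w
      {𝓛} apply {T} rowSum≈ {max T} (Real.≤-max T) fin-nonZero {μ}

  constant⇒≈max : ∀ {T : Fin q → ℝ} → (∀ F G → T F ≈ T G) → ∀ F → T F ≈ max T
  constant⇒≈max {T} const F = begin
    T F                   ≈⟨ Real.max-const {q} (T F) ⟨
    max {q} (λ _ → T F)   ≈⟨ Real.max-cong {f = λ _ → T F} {T} (const F) ⟩
    max T                 ∎

  equality⇔ : ∀ {𝓛 T} → Packed IsFactored 𝓛 → Packed IsRowSums T →
    Connected _∼_ → (∀ E → ∃[ F ] E ∼ F) →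
    ∀ {Balanced : Set} → (¬ ¬ Balanced → Balanced) →
    (Potential _∼_ s → Balanced) →
    (Fin p → Balanced → Potential _∼_ s) →
    ∀ {μ} → IsLargestEigenvalue 𝓛 μ → (μ ≈ max T) ⇔ (Balanced × (∀ F G → T F ≈ T G))
  equality⇔ {𝓛} {T} (pack apply) (pack rowSum≈) connected coface {Bal} stable to from
            {μ} (isEigenvalue , largest) =
    RealOrder.Laplacian.Spectrum.equality⇔ _∼?_ s (λ {E} {F} → s-sign E F) (λ {E} {F} → s-zero E F) r 0<r w 0<w
      {𝓛} apply {T} rowSum≈ {max T} (Real.≤-max T) connected coface (constant⇒≈max {T}) {Bal} stable to from
      fin-nonZero {μ} isEigenvalue largest

-- Integer signs, signed walks and balance

open import Relation.Binary.Construct.Closure.ReflexiveTransitive using (Star; ε; _◅_; _◅◅_)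

sign-power : ∀ n → IsSign (-1ℤ ℤ.^ n)
sign-power zero    = inj₁ refl
sign-power (suc n) = sign-* (inj₂ refl) (sign-power n)

sign-negate : ∀ {a} → IsSign a → IsSign (ℤ.- a)
sign-negate (inj₁ refl) = inj₂ refl
sign-negate (inj₂ refl) = inj₁ refl

positive-sign : ∀ {a} → IsSign a → 0ℤ ℤ.< a → a ≡ 1ℤ
positive-sign (inj₁ refl) _ = refl
positive-sign (inj₂ refl) ()

sign-transpose : ∀ {a b c} → IsSign a → a ℤ.* b ≡ c → b ≡ a ℤ.* c
sign-transpose {a} {b} sa refl = begin
  b                    ≡⟨ ℤ.*-identityˡ b ⟨
  1ℤ ℤ.* b             ≡⟨ cong (ℤ._* b) (sign-square sa) ⟨
  a ℤ.* a ℤ.* b        ≡⟨ ℤ.*-assoc a a b ⟩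
  a ℤ.* (a ℤ.* b)      ∎
  where open ≡-Reasoning

-- Walks in a signed graph

module SignedWalks {V : Set} (_≟_ : DecidableEquality V) {_∼_ : V → V → Set}
  (∼-irrefl : ∀ {u} → ¬ u ∼ u) (e : V → V → ℤ) (e-sym : ∀ {u v} → u ∼ v → e u v ≡ e v u)
  (e-sign : ∀ {u v} → u ∼ v → IsSign (e u v)) where

  open DecMembership _≟_ using (_∈?_)

  -- The last vertex is left out.
  visited : ∀ {u v} → Star _∼_ u v → List V
  visited ε             = []
  visited {u} (_ ◅ p)   = u ∷ visited p

  len : ∀ {u v} → Star _∼_ u v → ℕ
  len p = length (visited p)

  sign : ∀ {u v} → Star _∼_ u v → ℤ
  sign ε                     = 1ℤ
  sign (_◅_ {u} {v} _ p)     = e u v ℤ.* sign p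

  sign-isSign : ∀ {u v} (p : Star _∼_ u v) → IsSign (sign p)
  sign-isSign ε       = inj₁ refl
  sign-isSign (a ◅ p) = sign-* (e-sign a) (sign-isSign p)

  sign-◅◅ : ∀ {u v w} (p : Star _∼_ u v) (q : Star _∼_ v w) → sign (p ◅◅ q) ≡ sign p ℤ.* sign q
  sign-◅◅ ε                 q = sym (ℤ.*-identityˡ (sign q))
  sign-◅◅ (_◅_ {u} {v} _ p) q = trans (cong (e u v ℤ.*_) (sign-◅◅ p q)) (sym (ℤ.*-assoc (e u v) (sign p) (sign q)))

  len-◅◅ : ∀ {u v w} (p : Star _∼_ u v) (q : Star _∼_ v w) → len (p ◅◅ q) ≡ len p ℕ.+ len q
  len-◅◅ ε       q = refl
  len-◅◅ (_ ◅ p) q = cong suc (len-◅◅ p q)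

  -- Because `visited` omits the end of a walk, a visited vertex is left by at least one more step,
  -- whence the bound on `c`.
  split : ∀ {u v w} (p : Star _∼_ u v) → w ∈ visited p →
          ∃[ a ] ∃[ c ] (p ≡ a ◅◅ c × 1 ℕ.≤ len {w} c)
  split (x ◅ p) (here refl) = ε , x ◅ p , refl , s≤s z≤n
  split (x ◅ p) (there w∈p) with split p w∈p
  ... | a , c , refl , c≥1 = x ◅ a , c , refl , c≥1

  -- A walk cut at a repeated vertex. Nonemptiness of `loop` makes the walk without it shorter, and
  -- nonemptiness of `after` makes `loop` itself shorter.
  record Detour {u v} (p : Star _∼_ u v) : Set where
    field
      {turn}  : V
      before  : Star _∼_ u turn
      loop    : Star _∼_ turn turn
      after   : Star _∼_ turn v
      loop≥1  : 1 ℕ.≤ len loop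
      after≥1 : 1 ℕ.≤ len after
      split≡  : p ≡ before ◅◅ loop ◅◅ after

  simple-or-detour : ∀ {u v} (p : Star _∼_ u v) → Unique (visited p) ⊎ Detour p
  simple-or-detour ε = inj₁ []
  simple-or-detour {u} (x ◅ p) with u ∈? visited p | simple-or-detour p
  ... | no u∉p | inj₁ simple = inj₁ (¬Any⇒All¬ (visited p) u∉p ∷ simple)
  ... | no _   | inj₂ d      = inj₂ record
    { Detour d ; before = x ◅ Detour.before d ; split≡ = cong (x ◅_) (Detour.split≡ d) }
  ... | yes u∈p | _ with split p u∈p
  ...   | a , c , refl , c≥1 = inj₂ record
    { before = ε ; loop = x ◅ a ; after = c ; loop≥1 = s≤s z≤n ; after≥1 = c≥1 ; split≡ = refl }

  module BalancedWalks
    (cycle : ∀ {u} (p : Star _∼_ u u) → Unique (visited p) → 3 ℕ.≤ len p → sign p ≡ 1ℤ) where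

    -- Cycles need length at least three. Length one is excluded by irreflexivity, and a closed walk
    -- of length two runs along an edge and back, so its sign is a square.
    simple-closed : ∀ {u} (p : Star _∼_ u u) → Unique (visited p) → sign p ≡ 1ℤ
    simple-closed ε                           _ = refl
    simple-closed (x ◅ ε)                     _ = contradiction x ∼-irrefl
    simple-closed (_◅_ {u} {v} x (y ◅ ε))     _ = begin
      e u v ℤ.* (e v u ℤ.* 1ℤ)   ≡⟨ cong (e u v ℤ.*_) (trans (ℤ.*-identityʳ (e v u)) (e-sym y)) ⟩
      e u v ℤ.* e u v            ≡⟨ sign-square (e-sign x) ⟩
      1ℤ                         ∎
      where open ≡-Reasoning
    simple-closed p@(_ ◅ _ ◅ _ ◅ _)       simple = cycle p simple (s≤s (s≤s (s≤s z≤n)))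

    private
      -- Induction on a length bound: a repeated vertex splits a closed walk into a loop and the
      -- closed walk that skips it. Both are shorter, and signs are multiplicative.
      closed-≤ : ∀ n {u} (p : Star _∼_ u u) → len p ℕ.≤ n → sign p ≡ 1ℤ
      closed-≤ zero    ε _ = refl
      closed-≤ (suc n) p p≤n with simple-or-detour p
      ... | inj₁ simple = simple-closed p simple
      ... | inj₂ record { before = a ; loop = l ; after = c ; loop≥1 = l≥1 ; after≥1 = c≥1 ; split≡ = refl } = begin
        sign (a ◅◅ l ◅◅ c)                   ≡⟨ sign-◅◅ a (l ◅◅ c) ⟩
        sign a ℤ.* sign (l ◅◅ c)             ≡⟨ cong (sign a ℤ.*_) (sign-◅◅ l c) ⟩
        sign a ℤ.* (sign l ℤ.* sign c)       ≡⟨ cong (λ z → sign a ℤ.* (z ℤ.* sign c)) (closed-≤ n l l≤n) ⟩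
        sign a ℤ.* (1ℤ ℤ.* sign c)           ≡⟨ cong (sign a ℤ.*_) (ℤ.*-identityˡ (sign c)) ⟩
        sign a ℤ.* sign c                    ≡⟨ sign-◅◅ a c ⟨
        sign (a ◅◅ c)                        ≡⟨ closed-≤ n (a ◅◅ c) ac≤n ⟩
        1ℤ                                   ∎
        where
        open ≡-Reasoning
        total : len a ℕ.+ (len l ℕ.+ len c) ℕ.≤ suc n
        total = subst (ℕ._≤ suc n) (trans (len-◅◅ a (l ◅◅ c)) (cong (len a ℕ.+_) (len-◅◅ l c))) p≤n
        l≤n : len l ℕ.≤ n
        l≤n = ℕ.s≤s⁻¹ (ℕ.≤-trans (subst (ℕ._≤ len l ℕ.+ len c) (ℕ.+-comm (len l) 1) (ℕ.+-monoʳ-≤ (len l) c≥1))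
                (ℕ.≤-trans (ℕ.m≤n+m _ (len a)) total))
        ac≤n : len (a ◅◅ c) ℕ.≤ n
        ac≤n = subst (ℕ._≤ n) (sym (len-◅◅ a c)) (ℕ.s≤s⁻¹ (ℕ.≤-trans
                 (subst (ℕ._≤ len a ℕ.+ (len l ℕ.+ len c)) (ℕ.+-suc (len a) (len c))
                   (ℕ.+-monoʳ-≤ (len a) (ℕ.+-monoˡ-≤ (len c) l≥1))) total))

    closed : ∀ {u} (p : Star _∼_ u u) → sign p ≡ 1ℤ
    closed p = closed-≤ (len p) p ℕ.≤-refl

    -- Going to `u`, across the edge and back from `v` is a closed walk, and so is going to `v` and
    -- back. Both have sign 1 and share the way back, whose sign cancels. The walk `return v` spares
    -- the reversal of `reach v`.
    potential : ∀ {root} (reach : ∀ v → Star _∼_ root v) (return : ∀ v → Star _∼_ v root) →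
                ∀ {u v} → u ∼ v → e u v ≡ sign (reach u) ℤ.* sign (reach v)
    potential reach return {u} {v} x = sign-transpose (sign-isSign (reach u)) (begin
      a ℤ.* e u v            ≡⟨ ℤ.*-identityʳ _ ⟨
      a ℤ.* e u v ℤ.* 1ℤ     ≡⟨ cong (a ℤ.* e u v ℤ.*_) (sign-square (sign-isSign (return v))) ⟨
      a ℤ.* e u v ℤ.* (b ℤ.* b)       ≡⟨ ℤ.*-assoc (a ℤ.* e u v) b b ⟨
      a ℤ.* e u v ℤ.* b ℤ.* b         ≡⟨ cong (ℤ._* b) (ℤ.*-assoc a (e u v) b) ⟩
      a ℤ.* (e u v ℤ.* b) ℤ.* b       ≡⟨ cong (ℤ._* b) (sign-◅◅ (reach u) (x ◅ return v)) ⟨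
      sign (reach u ◅◅ x ◅ return v) ℤ.* b        ≡⟨ cong (ℤ._* b) (closed (reach u ◅◅ x ◅ return v)) ⟩
      1ℤ ℤ.* b                        ≡⟨ cong (ℤ._* b) (closed (reach v ◅◅ return v)) ⟨
      sign (reach v ◅◅ return v) ℤ.* b            ≡⟨ cong (ℤ._* b) (sign-◅◅ (reach v) (return v)) ⟩
      sign (reach v) ℤ.* b ℤ.* b      ≡⟨ ℤ.*-assoc (sign (reach v)) b b ⟩
      sign (reach v) ℤ.* (b ℤ.* b)    ≡⟨ cong (sign (reach v) ℤ.*_) (sign-square (sign-isSign (return v))) ⟩
      sign (reach v) ℤ.* 1ℤ           ≡⟨ ℤ.*-identityʳ _ ⟩
      sign (reach v)                  ∎)
      where
      open ≡-Reasoning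
      a = sign (reach u)
      b = sign (return v)

-- Incidence signs and balance of the graph of facets

module Incidence (K : SimplicialComplex) (o : Orientation K) (i : ℕ) where
  open SimplicialComplex K
  open B K i renaming (Connected to Connected′)

  card : ∀ {j} (E : S K j) → ∣ set K E ∣ ≡ suc j
  card {j} E = proj₂ (All.lookup (all-filter (ofDim? K j) (subsets vertices)) (∈-lookup {xs = faces K j} E))

  -- Some vertex `x` of `F` is missing from `E`, so `E` lies in `F` minus `x`. Proper inclusion
  -- would need `F` minus `x` to have more than `i + 1` elements, but it has fewer than `i + 2`.
  -- Hence the search in `sgn` succeeds whenever `E ⊏ F`.
  facet-removes-vertex : ∀ {E : S K i} {F : S K (suc i)} → _⊏_ K E F →
    ∃[ j ] set K E ≡ set K F Subset.- Vec.lookup (sequence (o F)) j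
  facet-removes-vertex {E} {F} (E⊆F , x , x∈F , x∉E) = j , trans E≡F-x (cong (set K F Subset.-_) x≡)
    where
    x∈seq = Equivalence.to (complete (o F) x) x∈F
    j = VecAny.index x∈seq
    x≡ : x ≡ Vec.lookup (sequence (o F)) j
    x≡ = VecAny.lookup-index x∈seq

    E⊆F-x : set K E Subset.⊆ set K F Subset.- x
    E⊆F-x y∈E = Subset.x∈p∧x≢y⇒x∈p-y (E⊆F y∈E) λ { refl → x∉E y∈E }

    E⊄F-x : ¬ set K E Subset.⊂ set K F Subset.- x
    E⊄F-x E⊂F-x = ℕ.<-irrefl refl (ℕ.≤-trans
      (s≤s (subst (ℕ._< ∣ set K F Subset.- x ∣) (card E) (Subset.p⊂q⇒∣p∣<∣q∣ E⊂F-x)))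
      (subst (∣ set K F Subset.- x ∣ ℕ.<_) (card F) (Subset.x∈p⇒∣p-x∣<∣p∣ x∈F)))

    E≡F-x : set K E ≡ set K F Subset.- x
    E≡F-x = Subset.⊆-antisym E⊆F-x λ {y} y∈F-x → case-∈ y y∈F-x (y Subset.∈? set K E)
      where
      case-∈ : ∀ y → y Subset.∈ set K F Subset.- x → Dec (y Subset.∈ set K E) → y Subset.∈ set K E
      case-∈ y _     (yes y∈E) = y∈E
      case-∈ y y∈F-x (no y∉E)  =
        contradiction {A = set K E Subset.⊂ set K F Subset.- x} (E⊆F-x , y , y∈F-x , y∉E) E⊄F-x

  removal-is-facet : ∀ {E : S K i} {F : S K (suc i)} j →
    set K E ≡ set K F Subset.- Vec.lookup (sequence (o F)) j → _⊏_ K E F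
  removal-is-facet {E} {F} j eq = subst (Subset._⊂ set K F) (sym eq)
    (Subset.x∈p⇒p-x⊂p (Equivalence.from (complete (o F) _) (Vec.∈-lookup j (sequence (o F)))))

  sgn-sign : ∀ {E : S K i} {F : S K (suc i)} → _⊏_ K E F → IsSign (sgn K o E F)
  sgn-sign {E} {F} E⊏F
    with Fin.any? (λ j → Vec.≡-dec Bool._≟_ (set K E) (set K F Subset.- Vec.lookup (sequence (o F)) j))
  ... | no ¬∃ = contradiction (facet-removes-vertex {E} {F} E⊏F) ¬∃
  ... | yes (j , _) with sameOrientation? (sequence (o E)) (Vec.removeAt (sequence (o F)) j)
  ...   | yes _ = sign-power (toℕ j)
  ...   | no _  = sign-negate (sign-power (toℕ j))

  sgn-zero : ∀ {E : S K i} {F : S K (suc i)} → ¬ _⊏_ K E F → sgn K o E F ≡ 0ℤ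
  sgn-zero {E} {F} E⋢F
    with Fin.any? (λ j → Vec.≡-dec Bool._≟_ (set K E) (set K F Subset.- Vec.lookup (sequence (o F)) j))
  ... | no _ = refl
  ... | yes (j , eq) = contradiction (removal-is-facet {E} {F} j eq) E⋢F

  _≟_ : DecidableEquality Vertex
  _≟_ = ≡-dec Fin._≟_ Fin._≟_

  adjacent-irrefl : ∀ {u} → ¬ Adjacent u u
  adjacent-irrefl {inj₁ _} ()
  adjacent-irrefl {inj₂ _} ()

  edgeSign-sym : ∀ {u v} → Adjacent u v → edgeSign o u v ≡ edgeSign o v u
  edgeSign-sym {inj₁ _} {inj₂ _} _ = refl
  edgeSign-sym {inj₂ _} {inj₁ _} _ = refl

  edgeSign-sign : ∀ {u v} → Adjacent u v → IsSign (edgeSign o u v)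
  edgeSign-sign {inj₁ E} {inj₂ F} E⊏F = sgn-sign {E} {F} E⊏F
  edgeSign-sign {inj₂ F} {inj₁ E} E⊏F = sgn-sign {E} {F} E⊏F

  open SignedWalks _≟_ {Adjacent} (λ {u} → adjacent-irrefl {u}) (edgeSign o)
    (λ {u} {v} → edgeSign-sym {u} {v}) (λ {u} {v} → edgeSign-sign {u} {v})

  visited-linked : ∀ {u v} (p : Star Adjacent u v) → Linked Adjacent (visited p ∷ʳ v)
  visited-linked ε               = [-]
  visited-linked (x ◅ ε)         = x ∷ [-]
  visited-linked (x ◅ p@(_ ◅ _)) = x ∷ visited-linked p

  walkSign-visited : ∀ {u v} (p : Star Adjacent u v) → walkSign o (visited p ∷ʳ v) ≡ sign p
  walkSign-visited ε                           = refl
  walkSign-visited (x ◅ ε)                     = refl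
  walkSign-visited (_◅_ {u} {v} x p@(_ ◅ _))   = cong (edgeSign o u v ℤ.*_) (walkSign-visited p)

  -- Harary's characterisation: a signed graph is balanced exactly when every
  -- edge sign is the product of signs attached to its ends.
  IsPotential : (Vertex → ℤ) → Set
  IsPotential ρ = (∀ v → IsSign (ρ v)) × (∀ {u v} → Adjacent u v → edgeSign o u v ≡ ρ u ℤ.* ρ v)

  balanced⇒potential : Connected′ → Vertex → Balanced o → ∃[ ρ ] IsPotential ρ
  balanced⇒potential connected root balanced =
    (λ v → sign (connected root v)) , (λ v → sign-isSign (connected root v)) ,
    λ {u} {v} → BalancedWalks.potential cycle (connected root) (λ v → connected v root) {u} {v}
    where
    cycle : ∀ {u} (p : Star Adjacent u u) → Unique (visited p) → 3 ℕ.≤ len p → sign p ≡ 1ℤ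
    -- `visited p` is `u` followed by `visited p′`, and `IsCycle` counts only the latter, so three
    -- visited vertices become the required two.
    cycle {u} p@(_ ◅ p′) simple (s≤s p′≥2) = positive-sign (sign-isSign p)
      (subst (0ℤ ℤ.<_) (walkSign-visited p) (balanced u (visited p′)
        record { distinct = simple ; long = p′≥2 ; adjacent = visited-linked p }))

  potential⇒balanced : ∀ {ρ} → IsPotential ρ → Balanced o
  potential⇒balanced {ρ} (ρ-sign , ρ-edge) u xs c =
    subst (0ℤ ℤ.<_) (sym (trans (telescope u xs u (IsCycle.adjacent c)) (sign-square (ρ-sign u)))) (ℤ.+<+ (s≤s z≤n))
    where
    open ≡-Reasoning
    telescope : ∀ u xs v → Linked Adjacent (u ∷ xs ∷ʳ v) → walkSign o (u ∷ xs ∷ʳ v) ≡ ρ u ℤ.* ρ v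
    telescope u []       v (x ∷ _) = trans (ℤ.*-identityʳ _) (ρ-edge x)
    telescope u (y ∷ ys) v (x ∷ l) = begin
      edgeSign o u y ℤ.* walkSign o (y ∷ ys ∷ʳ v)   ≡⟨ cong₂ ℤ._*_ (ρ-edge x) (telescope y ys v l) ⟩
      ρ u ℤ.* ρ y ℤ.* (ρ y ℤ.* ρ v)                 ≡⟨ ℤ.*-assoc (ρ u) (ρ y) _ ⟩
      ρ u ℤ.* (ρ y ℤ.* (ρ y ℤ.* ρ v))               ≡⟨ cong (ρ u ℤ.*_) (sign-transpose (ρ-sign y) refl) ⟨
      ρ u ℤ.* ρ v                                   ∎

  -- Some upper face exists, and the first step of a path from `E` towards it can only lead to a
  -- coface of `E`.
  coface : .{{_ : NonZero (#S K (suc i))}} → Connected′ → ∀ E → ∃[ F ] _⊏_ K {i} E F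
  coface connected E with connected (inj₁ E) (inj₂ fin-nonZero)
  ... | _◅_ {j = inj₂ F} E⊏F _ = F , E⊏F

  connected-induction : Connected′ → (P : S K i → Set) (Q : S K (suc i) → Set) →
    (∀ {E F} → _⊏_ K E F → P E → Q F) → (∀ {E F} → _⊏_ K E F → Q F → P E) →
    ∀ F → Q F → (∀ E → P E) × (∀ F → Q F)
  connected-induction connected P Q up down F q =
    (λ E → along (connected (inj₂ F) (inj₁ E)) q) , (λ G → along (connected (inj₂ F) (inj₂ G)) q)
    where
    Holds : Vertex → Set
    Holds (inj₁ E) = P E
    Holds (inj₂ F) = Q F

    along : ∀ {u v} → Star Adjacent u v → Holds u → Holds v
    along ε                                h = h
    along (_◅_ {inj₁ E} {inj₂ F} E⊏F path) h = along path (up {E} {F} E⊏F h)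
    along (_◅_ {inj₂ F} {inj₁ E} E⊏F path) h = along path (down {E} {F} E⊏F h)

  -- Positivity of an integer is decidable, so the double negation can be removed separately for
  -- each cycle.
  balanced-stable : ¬ ¬ Balanced o → Balanced o
  balanced-stable ¬¬balanced u xs c = decidable-stable (0ℤ ℤ.<? walkSign o (u ∷ xs ∷ʳ u))
    λ unbalanced → ¬¬balanced λ balanced → unbalanced (balanced u xs c)

  potential⇒Balanced : Potential (_⊏_ K {i}) (sgn K o) → Balanced o
  potential⇒Balanced ρ = potential⇒balanced {value}
    ( (λ { (inj₁ E) → lower-sign E ; (inj₂ F) → upper-sign F })
    , λ { {inj₁ E} {inj₂ F} E⊏F → edge {E} {F} E⊏F
        ; {inj₂ F} {inj₁ E} E⊏F → trans (edge {E} {F} E⊏F) (ℤ.*-comm (lower E) (upper F)) })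
    where
    open Potential ρ

    value : Vertex → ℤ
    value (inj₁ E) = lower E
    value (inj₂ F) = upper F

  Balanced⇒potential : Connected′ → S K i → Balanced o → Potential (_⊏_ K {i}) (sgn K o)
  Balanced⇒potential connected E balanced =
    let ρ , ρ-sign , ρ-edge = balanced⇒potential connected (inj₁ E) balanced
    in record
      { lower      = λ E → ρ (inj₁ E)
      ; upper      = λ F → ρ (inj₂ F)
      ; lower-sign = λ E → ρ-sign (inj₁ E)
      ; upper-sign = λ F → ρ-sign (inj₂ F)
      ; edge       = λ {E} {F} E⊏F → ρ-edge {inj₁ E} {inj₂ F} E⊏F
      }

-- The up-Laplacians of a simplicial complex

recipWeight : (K : SimplicialComplex) (i : ℕ) → Weight K → S K i → ℝ
recipWeight K i w E = recip (w (simplex K E))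

recipWeight-positive : ∀ K i w E → 0ℝ < recipWeight K i w E
recipWeight-positive K i w E = Real.recip-positive (w (simplex K E))

weight : (K : SimplicialComplex) (j : ℕ) → Weight K → S K j → ℝ
weight K j w F = proj₁ (w (simplex K F))

weight-positive : ∀ K j w F → 0ℝ < weight K j w F
weight-positive K j w F = proj₂ (w (simplex K F))

recipWeight-unfold : ∀ K i w → recipWeight K i w ≡ λ E → recip (w (simplex K E))
recipWeight-unfold K i w = refl

W⁻¹≡ : ∀ K i w → W⁻¹ K w i ≡ diag (recipWeight K i w)
W⁻¹≡ K i w = refl

W≡ : ∀ K j w → W K w j ≡ diag (weight K j w)
W≡ K j w = refl

deg≡ : ∀ K i w (E : S K i) →
       deg K w E ≡ ∑ +-0-rawMonoid λ F → if ⌊ _⊏?_ K E F ⌋ then weight K (suc i) w F else 0ℝ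
deg≡ K i w E = refl

degreeSum≡ : ∀ K i (d : S K i → ℝ) F →
             sumOverFacets K F d ≡ ∑ +-0-rawMonoid λ E → if ⌊ _⊏?_ K E F ⌋ then d E else 0ℝ
degreeSum≡ K i d F = refl

module UpLaplacian (K : SimplicialComplex) (i : ℕ) .{{_ : NonZero (#S K (suc i))}} (w : Weight K)
  (s : S K i → S K (suc i) → ℤ)
  (s-sign : ∀ E F → _⊏_ K E F → IsSign (s E F)) (s-zero : ∀ E F → ¬ _⊏_ K E F → s E F ≡ 0ℤ) where

  module L = RealLaplacian {#S K i} {#S K (suc i)} {_⊏_ K} (_⊏?_ K) s
    s-sign s-zero (recipWeight K i w) (recipWeight-positive K i w) (weight K (suc i) w)
    (weight-positive K (suc i) w)

  up-factored : ∀ {𝓛 R N M} → Packed L.IsSigned M → R ≡ diag (recipWeight K i w) → N ≡ diag (weight K (suc i) w) →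
                𝓛 ≡ R ⊗ M ᵀ ⊗ N ⊗ M → Packed L.IsFactored 𝓛
  up-factored {𝓛} {R} {N} {M} M-signed R≡ N≡ 𝓛≡ = L.factor {𝓛} {R} {M} {N} R≡ N≡ M-signed 𝓛≡

  weighted-rowSums : Packed L.IsRowSums (λ F → sumOverFacets K F (λ E → deg K w E * recipWeight K i w E))
  weighted-rowSums = L.weighted-rowSums {λ E → deg K w E}
    {λ F → sumOverFacets K F (λ E → deg K w E * recipWeight K i w E)}
    (deg≡ K i w) (degreeSum≡ K i (λ E → deg K w E * recipWeight K i w E))

  unweighted-rowSums : (∀ E → recipWeight K i w E ≈ 1ℝ) → Packed L.IsRowSums (λ F → sumOverFacets K F (deg K w))
  unweighted-rowSums r≈1 = L.unweighted-rowSums {λ E → deg K w E} {λ F → sumOverFacets K F (deg K w)}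
    (deg≡ K i w) r≈1 (degreeSum≡ K i (deg K w))

  𝓛-factored : ∀ {𝓛 M} → Packed L.IsSigned M → 𝓛 ≡ W⁻¹ K w i ⊗ M ᵀ ⊗ W K w (suc i) ⊗ M →
               Packed L.IsFactored 𝓛
  𝓛-factored {𝓛} {M} M-signed 𝓛≡ =
    up-factored {𝓛} {W⁻¹ K w i} {W K w (suc i)} {M} M-signed (W⁻¹≡ K i w) (W≡ K (suc i) w) 𝓛≡

  recipWeight-bound : ∀ {𝓛} → Packed L.IsFactored 𝓛 → ∀ {μ} → IsEigenvalue 𝓛 μ →
                   μ ≤ max (λ F → sumOverFacets K F (λ E → deg K w E * recipWeight K i w E))
  recipWeight-bound {𝓛} factored {μ} isEigenvalue =
    L.eigenvalue-≤-max {𝓛} {λ F → sumOverFacets K F (λ E → deg K w E * recipWeight K i w E)}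
      factored weighted-rowSums {μ} isEigenvalue

  max-cong-r : ∀ {μ r′} → recipWeight K i w ≡ r′ →
               μ ≤ max (λ F → sumOverFacets K F (λ E → deg K w E * recipWeight K i w E)) →
               μ ≤ max (λ F → sumOverFacets K F (λ E → deg K w E * r′ E))
  max-cong-r refl bound = bound

  weighted-bound : ∀ {𝓛} → Packed L.IsFactored 𝓛 → ∀ {μ} → IsEigenvalue 𝓛 μ →
                    μ ≤ max (λ (F : S K (suc i)) → sumOverFacets K F (λ E → deg K w E * recip (w (simplex K E))))
  weighted-bound {𝓛} factored {μ} isEigenvalue =
    max-cong-r {μ} {λ E → recip (w (simplex K E))} (recipWeight-unfold K i w)
      (recipWeight-bound {𝓛} factored {μ} isEigenvalue)

  module _ (r≈1 : ∀ E → recipWeight K i w E ≈ 1ℝ) where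

    unweighted-bound : ∀ {𝓛} → Packed L.IsFactored 𝓛 → ∀ {μ} → IsEigenvalue 𝓛 μ →
                       μ ≤ max (λ (F : S K (suc i)) → sumOverFacets K F (deg K w))
    unweighted-bound {𝓛} factored {μ} isEigenvalue =
      L.eigenvalue-≤-max {𝓛} {λ F → sumOverFacets K F (deg K w)} factored (unweighted-rowSums r≈1) {μ} isEigenvalue

    unweighted-equality : ∀ {𝓛} → Packed L.IsFactored 𝓛 → Connected (_⊏_ K) → (∀ E → ∃[ F ] _⊏_ K E F) →
      ∀ {Balanced : Set} → (¬ ¬ Balanced → Balanced) →
      (Potential (_⊏_ K) s → Balanced) → (S K i → Balanced → Potential (_⊏_ K) s) →
      ∀ {μ} → IsLargestEigenvalue 𝓛 μ →
      (μ ≈ max (λ (F : S K (suc i)) → sumOverFacets K F (deg K w))) ⇔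
      (Balanced × (∀ (F F′ : S K (suc i)) → sumOverFacets K F (deg K w) ≈ sumOverFacets K F′ (deg K w)))
    unweighted-equality {𝓛} factored connected coface {Balanced} stable to from {μ} isLargest =
      L.equality⇔ {𝓛} {λ F → sumOverFacets K F (deg K w)} factored (unweighted-rowSums r≈1) connected coface
        {Balanced} stable to from {μ} isLargest

module _ (K : SimplicialComplex) (i : ℕ) (Balanced : Set) where

  -- What the spectral argument needs to know of an orientation. With `s` and `Balanced` as
  -- variables, `sgn` and the definition of balance are not unfolded there. The face taken by `from`
  -- is the root of the potential.
  record Signing : Set where
    field
      s      : S K i → S K (suc i) → ℤ
      s-sign : ∀ E F → _⊏_ K E F → IsSign (s E F)
      s-zero : ∀ E F → ¬ _⊏_ K E F → s E F ≡ 0ℤ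
      to     : Potential (_⊏_ K) s → Balanced
      from   : B.Connected K i → S K i → Balanced → Potential (_⊏_ K) s

  IsSigned : Signing → Matrix (#S K (suc i)) (#S K i) → Set
  IsSigned σ M = ∀ F E → M F E ≡ fromℤ (Signing.s σ E F)

  module _ .{{_ : NonZero (#S K (suc i))}} (w : Weight K) where

    IsUp : Matrix (#S K i) (#S K i) → Set
    IsUp 𝓛 = ∃ λ (σ : Signing) →
      let open Signing σ in Packed (UpLaplacian.L.IsFactored K i w s s-sign s-zero) 𝓛

    isUp : ∀ {𝓛 M} σ → Packed (IsSigned σ) M → 𝓛 ≡ W⁻¹ K w i ⊗ M ᵀ ⊗ W K w (suc i) ⊗ M → Packed IsUp 𝓛
    isUp {𝓛} {M} σ (pack M-signed) 𝓛≡ =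
      pack (σ , UpLaplacian.𝓛-factored K i w s s-sign s-zero {𝓛} {M} (pack M-signed) 𝓛≡)
      where open Signing σ

    up-bound : ∀ {𝓛} → Packed IsUp 𝓛 → ∀ {μ} → IsEigenvalue 𝓛 μ →
      μ ≤ max (λ (F : S K (suc i)) → sumOverFacets K F (λ E → deg K w E * recip (w (simplex K E))))
    up-bound {𝓛} (pack (σ , factored)) {μ} isEigenvalue =
      UpLaplacian.weighted-bound K i w s s-sign s-zero {𝓛} factored {μ} isEigenvalue
      where open Signing σ

    module _ (r≈1 : ∀ (E : S K i) → recip (w (simplex K E)) ≈ 1ℝ) where

      up-unweighted-bound : ∀ {𝓛} → Packed IsUp 𝓛 → ∀ {μ} → IsEigenvalue 𝓛 μ →
        μ ≤ max (λ (F : S K (suc i)) → sumOverFacets K F (deg K w))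
      up-unweighted-bound {𝓛} (pack (σ , factored)) {μ} isEigenvalue =
        UpLaplacian.unweighted-bound K i w s s-sign s-zero r≈1 {𝓛} factored {μ} isEigenvalue
        where open Signing σ

      up-equality : ∀ {𝓛} → Packed IsUp 𝓛 → B.Connected K i → Connected (_⊏_ K {i}) →
        (∀ (E : S K i) → ∃[ F ] _⊏_ K {i} E F) → (¬ ¬ Balanced → Balanced) → ∀ {μ} → IsLargestEigenvalue 𝓛 μ →
        (μ ≈ max (λ (F : S K (suc i)) → sumOverFacets K F (deg K w))) ⇔
        (Balanced × (∀ (F F′ : S K (suc i)) → sumOverFacets K F (deg K w) ≈ sumOverFacets K F′ (deg K w)))
      up-equality {𝓛} (pack (σ , factored)) connected induction coface stable {μ} isLargest =
        UpLaplacian.unweighted-equality K i w s s-sign s-zero r≈1 {𝓛} factored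
          induction coface {Balanced} stable to (from connected) {μ} isLargest
        where open Signing σ

Packed-resp : {A : Set} {P : A → Set} {x y : A} → y ≡ x → Packed P x → Packed P y
Packed-resp refl p = p

recip-1 : recip 1ℝ⁺ ≈ 1ℝ
recip-1 = Real.pointwise {recip 1ℝ⁺} {1ℝ} λ _ → refl

-- The orientation is a module parameter because an argument o : Orientation K is
-- elaborated to λ {j} → o {j}, which is not syntactically o.
module Main (K : SimplicialComplex) (o : Orientation K) (i : ℕ) where

  Bal : Set
  Bal = B.Balanced K i o

  σ : Signing K i Bal
  σ = record
    { s      = sgn K o
    ; s-sign = λ E F → Incidence.sgn-sign K o i {E} {F}
    ; s-zero = λ E F → Incidence.sgn-zero K o i {E} {F}
    ; to     = Incidence.potential⇒Balanced K o i
    ; from   = Incidence.Balanced⇒potential K o i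
    }

  D-signed : Packed (IsSigned K i Bal σ) (D K o i)
  D-signed = pack λ F E → refl

  𝓛up≡ : ∀ w → 𝓛up K w o i ≡ W⁻¹ K w i ⊗ D K o i ᵀ ⊗ W K w (suc i) ⊗ D K o i
  𝓛up≡ w = refl

  Lup≡ : Lup K o i ≡ 𝓛up K (unitWeight K) o i
  Lup≡ = refl

  module _ .{{_ : NonZero (#S K (suc i))}} where

    𝓛up-isUp : ∀ w → Packed (IsUp K i Bal w) (𝓛up K w o i)
    𝓛up-isUp w = isUp K i Bal w σ D-signed (𝓛up≡ w)

    weighted : ∀ (w : Weight K) (μ : ℝ) → IsLargestEigenvalue (𝓛up K w o i) μ →
      μ ≤ max (λ (F : S K (suc i)) → sumOverFacets K F (λ E → deg K w E * recip (w (simplex K E))))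
    weighted w μ (isEigenvalue , _) = up-bound K i Bal w (𝓛up-isUp w) {μ} isEigenvalue

    unweighted-≤ : ∀ (μ : ℝ) → IsLargestEigenvalue (Lup K o i) μ →
      μ ≤ max (λ (F : S K (suc i)) → sumOverFacets K F (deg K (unitWeight K)))
    unweighted-≤ μ (isEigenvalue , _) = up-unweighted-bound K i Bal (unitWeight K) (λ _ → recip-1)
      (Packed-resp Lup≡ (𝓛up-isUp (unitWeight K))) {μ} isEigenvalue

    unweighted-equality : ∀ (μ : ℝ) → IsLargestEigenvalue (Lup K o i) μ → B.Connected K i →
      (μ ≈ max (λ (F : S K (suc i)) → sumOverFacets K F (deg K (unitWeight K))))
      ⇔
      (B.Balanced K i o ×
      (∀ (F F′ : S K (suc i)) →
      sumOverFacets K F (deg K (unitWeight K)) ≈ sumOverFacets K F′ (deg K (unitWeight K))))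
    unweighted-equality μ isLargest connected = up-equality K i Bal (unitWeight K) (λ _ → recip-1)
      (Packed-resp Lup≡ (𝓛up-isUp (unitWeight K))) connected
      (Incidence.connected-induction K o i connected) (Incidence.coface K o i connected)
      (Incidence.balanced-stable K o i) {μ} isLargest

    unweighted : ∀ (μ : ℝ) → IsLargestEigenvalue (Lup K o i) μ →
        (μ ≤ max (λ (F : S K (suc i)) → sumOverFacets K F (deg K (unitWeight K))))
        ×
        (B.Connected K i →
        (μ ≈ max (λ (F : S K (suc i)) → sumOverFacets K F (deg K (unitWeight K))))
        ⇔
        (B.Balanced K i o ×
        (∀ (F F′ : S K (suc i)) →
        sumOverFacets K F (deg K (unitWeight K)) ≈ sumOverFacets K F′ (deg K (unitWeight K)))))
    unweighted μ isLargest = unweighted-≤ μ isLargest , unweighted-equality μ isLargest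

  theorem : .{{_ : NonZero (#S K (suc i))}} →
      (∀ (w : Weight K) (μ : ℝ) → IsLargestEigenvalue (𝓛up K w o i) μ →
      μ ≤ max (λ (F : S K (suc i)) → sumOverFacets K F (λ E → deg K w E * recip (w (simplex K E)))))
      ×
      (∀ (μ : ℝ) → IsLargestEigenvalue (Lup K o i) μ →
      (μ ≤ max (λ (F : S K (suc i)) → sumOverFacets K F (deg K (unitWeight K))))
      ×
      (B.Connected K i →
      (μ ≈ max (λ (F : S K (suc i)) → sumOverFacets K F (deg K (unitWeight K))))
      ⇔
      (B.Balanced K i o ×
      (∀ (F F′ : S K (suc i)) →
      sumOverFacets K F (deg K (unitWeight K)) ≈ sumOverFacets K F′ (deg K (unitWeight K))))))
  theorem {{nz}} = weighted {{nz}} , unweighted {{nz}}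

mainTheorem4 : (K : SimplicialComplex) (o : Orientation K) (i : ℕ) .{{_ : NonZero (#S K (suc i))}} →
    (∀ (w : Weight K) (μ : ℝ) → IsLargestEigenvalue (𝓛up K w o i) μ →
    μ ≤ max (λ (F : S K (suc i)) → sumOverFacets K F (λ E → deg K w E * recip (w (simplex K E)))))
    ×
    (∀ (μ : ℝ) → IsLargestEigenvalue (Lup K o i) μ →
    (μ ≤ max (λ (F : S K (suc i)) → sumOverFacets K F (deg K (unitWeight K))))
    ×
    (B.Connected K i →
    (μ ≈ max (λ (F : S K (suc i)) → sumOverFacets K F (deg K (unitWeight K))))
    ⇔
    (B.Balanced K i o ×
    (∀ (F F′ : S K (suc i)) →
    sumOverFacets K F (deg K (unitWeight K)) ≈ sumOverFacets K F′ (deg K (unitWeight K))))))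
mainTheorem4 = Main.theorem
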